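{- Let $[Q]$ be a toric poset. Then $\Psi_{\rm tor}^{[Q]}(\mathbf{x})$ can always be expressed over the denominator $$\prod_{\{i,j\}\in[Q]_{\rm Hasse}}(x_i-x_j),$$ where the product is taken over all edges $\{i,j\}$ of (the underlying graph of) the toric Hasse diagram $[Q]_{\rm Hasse}$; that is, $\Psi_{\rm tor}^{[Q]}(\mathbf{x})$ can be written as a polynomial divided by this product (each factor $x_i-x_j$ being taken up to sign).
   Context: All quivers are finite directed graphs that are simple (no loops, no parallel or anti-parallel arcs) and acyclic (no directed cycles), on a vertex set $V=[n]=\{1,\dots,n\}$. A source is a vertex all of whose incident arcs point away from it; a sink is a vertex all of whose incident arcs point into it (an isolated vertex is both). A flip at a source or sink $k$ reverses all arcs incident to $k$. Two acyclic quivers are equivalent if they are related by a finite sequence of flips; the equivalence class $[Q]$ of $Q$ is called a toric poset. All members of $[Q]$ have the same underlying undirected graph, called the underlying graph of $[Q]$. A toric directed path in a quiver $Q'$ is a sequence of distinct vertices $y_1,\dots,y_m$ such that $Q'$ contains the arcs $y_1\to y_2\to\cdots\to y_m$ and also the arc $y_1\to y_m$ (a single vertex and a single arc also count); its length is $m-1$. A toric directed path is maximal if it is maximal with respect to containment. For $Q'\in[Q]$, let $Q'_{\rm Hasse}$ be obtained from $Q'$ by removing each arc $i\to j$ for which $Q'$ contains a toric directed path from $i$ to $j$ that is both non-maximal and has length strictly greater than one. The toric Hasse diagram is $[Q]_{\rm Hasse}:=[Q'_{\rm Hasse}]$; it is known not to depend on the choice of $Q'\in[Q]$. For example, if $Q'$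 has arcs $1\to2$, $2\to3$, $2\to4$, $4\to5$, $1\to5$, $2\to5$, then $Q'_{\rm Hasse}$ has arcs $1\to2$, $2\to3$, $2\to4$, $4\to5$, $1\to5$. A toric total order $[w]=[(w_1,\dots,w_n)]$ is the equivalence class of a permutation $(w_1,\dots,w_n)$ of $V$ under cyclic rotation $(w_1,\dots,w_n)\mapsto(w_2,\dots,w_n,w_1)$. For a graph $G$ on $V$, let $\mathcal{A}_{\rm tor}(G)$ be the image in $\mathbb{R}^n/\mathbb{Z}^n$ of $\bigcup_{\{i,j\}\in G}\{x_i=x_j\}\subset\mathbb{R}^n$. A point of $\mathbb{R}^n/\mathbb{Z}^n-\mathcal{A}_{\rm tor}(G)$ determines an acyclic orientation of $G$: $i\to j$ if $x_i \bmod 1< x_j \bmod 1$ (values in $[0,1)$), and $j\to i$ otherwise. For a toric poset $[Q]$ with underlying graph $G$, its toric chamber $c_{[Q]}$ is the set of points whose orientation lies in $[Q]$ (these sets are exactly the connected components of $\mathbb{R}^n/\mathbb{Z}^n-\mathcal{A}_{\rm tor}(G)$). For a toric total order $[w]$, $c_{[w]}$ is the set of points with pairwise distinct coordinates such that listing the indices in increasing order of $x_i\bmod 1$ gives a member of $[w]$. $[w]$ is a toric total extension of $[Q]$ if $c_{[w]}\subseteq c_{[Q]}$; the set of these is $\mathcal{L}_{\rm tor}([Q])$. Define $\Psi_{\rm tor}^{[Q]}(\mathbf{x})=\sum_{[w]\in\mathcal{L}_{\rm tor}([Q])}\Psi_{\rm tor}^{[w]}(\mathbf{x})$, where $\Psi_{\rm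 tor}^{[w]}(\mathbf{x})=\dfrac{1}{(x_{w_1}-x_{w_2})(x_{w_2}-x_{w_3})\cdots(x_{w_{n-1}}-x_{w_n})(x_{w_n}-x_{w_1})}$ and $\mathbf{x}=(x_1,\dots,x_n)$ are indeterminates.
   Formalization: The formal theorem assumes n ≥ 3: for n = 2 the claim is false (Ψ = −1/(x₁−x₂)², while the Hasse product is x₁−x₂ or 1), and for n = 1 the function 1/(x₁−x₁) is undefined. -}

module Defs where

open import Algebra.Bundles using (CommutativeRing)
import Algebra.Properties.CommutativeSemigroup as CommutativeSemigroupProperties
import Algebra.Properties.Ring as RingProperties
open import Data.Bool.Base using (Bool; if_then_else_; _∨_; T)
open import Data.Fin.Base using (Fin; zero; suc) renaming (_<_ to _<ᶠ_)
open import Data.Fin.Properties using (_≟_)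
open import Data.List.Base
  using (List; []; _∷_; [_]; _++_; _∷ʳ_; map; foldr; zipWith; length; allFin)
open import Data.List.Relation.Binary.Infix.Heterogeneous using (Infix)
open import Data.List.Relation.Binary.Permutation.Propositional using (_↭_)
open import Data.List.Relation.Unary.All using (All; []; _∷_; all?)
open import Data.List.Relation.Unary.AllPairs using (AllPairs)
open import Data.List.Relation.Unary.Any using (Any)
open import Data.List.Relation.Unary.Linked using (Linked)
open import Data.List.Relation.Unary.Unique.Propositional using (Unique)
open import Data.Nat.Base using (ℕ; zero; suc; _∸_) renaming (_<_ to _<ⁿ_)
open import Data.Product using (_×_; _,_; ∃; ∃-syntax; uncurry)
open import Data.Rational.Base using (ℚ; 0ℚ; 1ℚ; 1/_; ≢-nonZero)
  renaming (_<_ to _<ℚ_; _*_ to _*ℚ_)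
import Data.Rational.Properties as ℚₚ
open import Data.Sum.Base using (_⊎_; inj₁; inj₂)
import Data.Sum.Base as Sum
open import Function.Bundles using (_⇔_)
open import Level using (Level; 0ℓ; _⊔_)
open import Relation.Binary.Bundles using (Setoid)
open import Relation.Binary.Core using (Rel)
open import Relation.Binary.Construct.Closure.ReflexiveTransitive using (Star)
open import Relation.Binary.Construct.Closure.Transitive using (TransClosure)
open import Relation.Binary.PropositionalEquality using (_≡_; refl; sym; trans; cong)
import Relation.Binary.Reasoning.Setoid as SetoidReasoning
open import Relation.Nullary.Decidable using (Dec; yes; no; ⌊_⌋; map′)
open import Relation.Nullary.Negation using (¬_; contradiction)
open import Relation.Unary using (Pred)

------------------------------------------------------------------------
-- Univariate polynomials over a commutative ring: lists of coefficients,
-- constant term first, identified when all coefficients agree (so that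
-- trailing zeros do not matter).

module Univariate (R : CommutativeRing 0ℓ 0ℓ) where

  open CommutativeRing R renaming (refl to ≈-refl; sym to ≈-sym; trans to ≈-trans)
  open RingProperties ring using (-0#≈0#)
  private module +ₚ = CommutativeSemigroupProperties +-commutativeSemigroup

  Poly : Set
  Poly = List Carrier

  coeff : Poly → ℕ → Carrier
  coeff []      _       = 0#
  coeff (a ∷ p) zero    = a
  coeff (a ∷ p) (suc k) = coeff p k

  infix 4 _≋_
  record _≋_ (p q : Poly) : Set where
    constructor mk≋
    field coeff≈ : ∀ k → coeff p k ≈ coeff q k
  open _≋_ public

  infixl 6 _⊕_
  _⊕_ : Poly → Poly → Poly
  []      ⊕ q       = q
  (a ∷ p) ⊕ []      = a ∷ p
  (a ∷ p) ⊕ (b ∷ q) = (a + b) ∷ (p ⊕ q)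

  ⊖_ : Poly → Poly
  ⊖_ = map (-_)

  scale : Carrier → Poly → Poly
  scale a = map (a *_)

  infixl 7 _⊗_
  _⊗_ : Poly → Poly → Poly
  []      ⊗ q = []
  (a ∷ p) ⊗ q = scale a q ⊕ (0# ∷ p ⊗ q)

  ≋-refl : ∀ {p} → p ≋ p
  ≋-refl = mk≋ λ _ → ≈-refl

  ≋-sym : ∀ {p q} → p ≋ q → q ≋ p
  ≋-sym e = mk≋ λ k → ≈-sym (coeff≈ e k)

  ≋-trans : ∀ {p q r} → p ≋ q → q ≋ r → p ≋ r
  ≋-trans e f = mk≋ λ k → ≈-trans (coeff≈ e k) (coeff≈ f k)

  ≋-setoid : Setoid 0ℓ 0ℓ
  ≋-setoid = record
    { Carrier = Poly ; _≈_ = _≋_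
    ; isEquivalence = record { refl = ≋-refl ; sym = ≋-sym ; trans = ≋-trans } }

  open SetoidReasoning ≋-setoid

  ∷-cong : ∀ {a b p q} → a ≈ b → p ≋ q → (a ∷ p) ≋ (b ∷ q)
  ∷-cong a≈b p≋q = mk≋ λ where
    zero    → a≈b
    (suc k) → coeff≈ p≋q k

  ∷-tail : ∀ {a b p q} → (a ∷ p) ≋ (b ∷ q) → p ≋ q
  ∷-tail e = mk≋ λ k → coeff≈ e (suc k)

  ∷-tail-zero : ∀ {a p} → (a ∷ p) ≋ [] → p ≋ []
  ∷-tail-zero e = mk≋ λ k → coeff≈ e (suc k)

  ∷-zero : ∀ {a p} → a ≈ 0# → p ≋ [] → (a ∷ p) ≋ []
  ∷-zero a≈0 p≋0 = mk≋ λ where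
    zero    → a≈0
    (suc k) → coeff≈ p≋0 k

  coeff-⊕ : ∀ p q k → coeff (p ⊕ q) k ≈ coeff p k + coeff q k
  coeff-⊕ []      q       k       = ≈-sym (+-identityˡ _)
  coeff-⊕ (a ∷ p) []      k       = ≈-sym (+-identityʳ _)
  coeff-⊕ (a ∷ p) (b ∷ q) zero    = ≈-refl
  coeff-⊕ (a ∷ p) (b ∷ q) (suc k) = coeff-⊕ p q k

  coeff-⊖ : ∀ p k → coeff (⊖ p) k ≈ - coeff p k
  coeff-⊖ []      k       = ≈-sym -0#≈0#
  coeff-⊖ (a ∷ p) zero    = ≈-refl
  coeff-⊖ (a ∷ p) (suc k) = coeff-⊖ p k

  coeff-scale : ∀ a p k → coeff (scale a p) k ≈ a * coeff p k
  coeff-scale a []      k       = ≈-sym (zeroʳ a)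
  coeff-scale a (b ∷ p) zero    = ≈-refl
  coeff-scale a (b ∷ p) (suc k) = coeff-scale a p k

  ⊕-cong : ∀ {p p′ q q′} → p ≋ p′ → q ≋ q′ → p ⊕ q ≋ p′ ⊕ q′
  ⊕-cong {p} {p′} {q} {q′} e f = mk≋ λ k →
    ≈-trans (coeff-⊕ p q k)
      (≈-trans (+-cong (coeff≈ e k) (coeff≈ f k)) (≈-sym (coeff-⊕ p′ q′ k)))

  ⊕-assoc : ∀ p q r → (p ⊕ q) ⊕ r ≋ p ⊕ (q ⊕ r)
  ⊕-assoc p q r = mk≋ λ k →
    ≈-trans (≈-trans (coeff-⊕ (p ⊕ q) r k) (+-congʳ (coeff-⊕ p q k)))
      (≈-trans (+-assoc _ _ _)
        (≈-sym (≈-trans (coeff-⊕ p (q ⊕ r) k) (+-congˡ (coeff-⊕ q r k)))))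

  ⊕-comm : ∀ p q → p ⊕ q ≋ q ⊕ p
  ⊕-comm p q = mk≋ λ k →
    ≈-trans (coeff-⊕ p q k) (≈-trans (+-comm _ _) (≈-sym (coeff-⊕ q p k)))

  ⊕-identityʳ : ∀ p → p ⊕ [] ≋ p
  ⊕-identityʳ p = ⊕-comm p []

  ⊖-cong : ∀ {p q} → p ≋ q → ⊖ p ≋ ⊖ q
  ⊖-cong {p} {q} e = mk≋ λ k →
    ≈-trans (coeff-⊖ p k) (≈-trans (-‿cong (coeff≈ e k)) (≈-sym (coeff-⊖ q k)))

  ⊖-inverseʳ : ∀ p → p ⊕ ⊖ p ≋ []
  ⊖-inverseʳ p = mk≋ λ k →
    ≈-trans (coeff-⊕ p (⊖ p) k) (≈-trans (+-congˡ (coeff-⊖ p k)) (-‿inverseʳ _))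

  ⊕-interchange : ∀ p q r s → (p ⊕ q) ⊕ (r ⊕ s) ≋ (p ⊕ r) ⊕ (q ⊕ s)
  ⊕-interchange p q r s = mk≋ λ k →
    ≈-trans (≈-trans (coeff-⊕ (p ⊕ q) (r ⊕ s) k) (+-cong (coeff-⊕ p q k) (coeff-⊕ r s k)))
      (≈-trans (+ₚ.interchange _ _ _ _)
        (≈-sym (≈-trans (coeff-⊕ (p ⊕ r) (q ⊕ s) k)
                        (+-cong (coeff-⊕ p r k) (coeff-⊕ q s k)))))

  ⊕-swap : ∀ p q r → p ⊕ (q ⊕ r) ≋ q ⊕ (p ⊕ r)
  ⊕-swap p q r = begin
    p ⊕ (q ⊕ r)  ≈⟨ ⊕-assoc p q r ⟨
    (p ⊕ q) ⊕ r  ≈⟨ ⊕-cong (⊕-comm p q) ≋-refl ⟩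
    (q ⊕ p) ⊕ r  ≈⟨ ⊕-assoc q p r ⟩
    q ⊕ (p ⊕ r)  ∎

  scale-cong : ∀ {a b p q} → a ≈ b → p ≋ q → scale a p ≋ scale b q
  scale-cong {a} {b} {p} {q} a≈b p≋q = mk≋ λ k →
    ≈-trans (coeff-scale a p k)
      (≈-trans (*-cong a≈b (coeff≈ p≋q k)) (≈-sym (coeff-scale b q k)))

  scale-zero : ∀ {a} p → a ≈ 0# → scale a p ≋ []
  scale-zero p a≈0 = mk≋ λ k →
    ≈-trans (coeff-scale _ p k) (≈-trans (*-congʳ a≈0) (zeroˡ _))

  scale-one : ∀ p → scale 1# p ≋ p
  scale-one p = mk≋ λ k → ≈-trans (coeff-scale 1# p k) (*-identityˡ _)

  scale-⊕ : ∀ a p q → scale a (p ⊕ q) ≋ scale a p ⊕ scale a q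
  scale-⊕ a p q = mk≋ λ k →
    ≈-trans (≈-trans (coeff-scale a (p ⊕ q) k) (*-congˡ (coeff-⊕ p q k)))
      (≈-trans (distribˡ a _ _)
        (≈-sym (≈-trans (coeff-⊕ (scale a p) (scale a q) k)
                        (+-cong (coeff-scale a p k) (coeff-scale a q k)))))

  scale-+ : ∀ a b p → scale (a + b) p ≋ scale a p ⊕ scale b p
  scale-+ a b p = mk≋ λ k →
    ≈-trans (coeff-scale (a + b) p k)
      (≈-trans (distribʳ _ a b)
        (≈-sym (≈-trans (coeff-⊕ (scale a p) (scale b p) k)
                        (+-cong (coeff-scale a p k) (coeff-scale b p k)))))

  scale-scale : ∀ a b p → scale a (scale b p) ≋ scale (a * b) p
  scale-scale a b p = mk≋ λ k →
    ≈-trans (≈-trans (coeff-scale a (scale b p) k) (*-congˡ (coeff-scale b p k)))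
      (≈-trans (≈-sym (*-assoc a b _)) (≈-sym (coeff-scale (a * b) p k)))

  shift-⊕ : ∀ p q → (0# ∷ (p ⊕ q)) ≋ (0# ∷ p) ⊕ (0# ∷ q)
  shift-⊕ p q = ∷-cong (≈-sym (+-identityˡ 0#)) ≋-refl

  ⊗-zeroʳ : ∀ p → p ⊗ [] ≋ []
  ⊗-zeroʳ []      = ≋-refl
  ⊗-zeroʳ (a ∷ p) = ∷-zero ≈-refl (⊗-zeroʳ p)

  ⊗-congˡ : ∀ p {q r} → q ≋ r → p ⊗ q ≋ p ⊗ r
  ⊗-congˡ []      e = ≋-refl
  ⊗-congˡ (a ∷ p) e = ⊕-cong (scale-cong ≈-refl e) (∷-cong ≈-refl (⊗-congˡ p e))

  ⊗-∷ʳ : ∀ p b q → p ⊗ (b ∷ q) ≋ scale b p ⊕ (0# ∷ p ⊗ q)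
  ⊗-∷ʳ []      b q = ≋-sym (∷-zero ≈-refl ≋-refl)
  ⊗-∷ʳ (a ∷ p) b q = ∷-cong (+-congʳ (*-comm a b)) (begin
    scale a q ⊕ p ⊗ (b ∷ q)                    ≈⟨ ⊕-cong ≋-refl (⊗-∷ʳ p b q) ⟩
    scale a q ⊕ (scale b p ⊕ (0# ∷ p ⊗ q))     ≈⟨ ⊕-swap (scale a q) (scale b p) _ ⟩
    scale b p ⊕ (scale a q ⊕ (0# ∷ p ⊗ q))     ∎)

  ⊗-comm : ∀ p q → p ⊗ q ≋ q ⊗ p
  ⊗-comm []      q = ≋-sym (⊗-zeroʳ q)
  ⊗-comm (a ∷ p) q = begin
    scale a q ⊕ (0# ∷ p ⊗ q)  ≈⟨ ⊕-cong ≋-refl (∷-cong ≈-refl (⊗-comm p q)) ⟩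
    scale a q ⊕ (0# ∷ q ⊗ p)  ≈⟨ ⊗-∷ʳ q a p ⟨
    q ⊗ (a ∷ p)               ∎

  ⊗-cong : ∀ {p p′ q q′} → p ≋ p′ → q ≋ q′ → p ⊗ q ≋ p′ ⊗ q′
  ⊗-cong {p} {p′} {q} {q′} e f = begin
    p ⊗ q    ≈⟨ ⊗-congˡ p f ⟩
    p ⊗ q′   ≈⟨ ⊗-comm p q′ ⟩
    q′ ⊗ p   ≈⟨ ⊗-congˡ q′ e ⟩
    q′ ⊗ p′  ≈⟨ ⊗-comm q′ p′ ⟩
    p′ ⊗ q′  ∎

  ⊗-distribˡ : ∀ p q r → p ⊗ (q ⊕ r) ≋ p ⊗ q ⊕ p ⊗ r
  ⊗-distribˡ []      q r = ≋-refl
  ⊗-distribˡ (a ∷ p) q r = begin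
    scale a (q ⊕ r) ⊕ (0# ∷ p ⊗ (q ⊕ r))
      ≈⟨ ⊕-cong (scale-⊕ a q r) (≋-trans (∷-cong ≈-refl (⊗-distribˡ p q r)) (shift-⊕ (p ⊗ q) (p ⊗ r))) ⟩
    (scale a q ⊕ scale a r) ⊕ ((0# ∷ p ⊗ q) ⊕ (0# ∷ p ⊗ r))
      ≈⟨ ⊕-interchange (scale a q) (scale a r) (0# ∷ p ⊗ q) (0# ∷ p ⊗ r) ⟩
    (scale a q ⊕ (0# ∷ p ⊗ q)) ⊕ (scale a r ⊕ (0# ∷ p ⊗ r))
      ∎

  ⊗-distribʳ : ∀ p q r → (q ⊕ r) ⊗ p ≋ q ⊗ p ⊕ r ⊗ p
  ⊗-distribʳ p q r = begin
    (q ⊕ r) ⊗ p      ≈⟨ ⊗-comm (q ⊕ r) p ⟩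
    p ⊗ (q ⊕ r)      ≈⟨ ⊗-distribˡ p q r ⟩
    p ⊗ q ⊕ p ⊗ r    ≈⟨ ⊕-cong (⊗-comm p q) (⊗-comm p r) ⟩
    q ⊗ p ⊕ r ⊗ p    ∎

  scale-⊗ : ∀ a p q → scale a p ⊗ q ≋ scale a (p ⊗ q)
  scale-⊗ a []      q = ≋-refl
  scale-⊗ a (b ∷ p) q = begin
    scale (a * b) q ⊕ (0# ∷ scale a p ⊗ q)
      ≈⟨ ⊕-cong (scale-scale a b q) (∷-cong (zeroʳ a) (≋-sym (scale-⊗ a p q))) ⟨
    scale a (scale b q) ⊕ scale a (0# ∷ p ⊗ q)
      ≈⟨ scale-⊕ a (scale b q) (0# ∷ p ⊗ q) ⟨
    scale a (scale b q ⊕ (0# ∷ p ⊗ q))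
      ∎

  shift-⊗ : ∀ p q → (0# ∷ p) ⊗ q ≋ (0# ∷ p ⊗ q)
  shift-⊗ p q = ⊕-cong {q = 0# ∷ p ⊗ q} (scale-zero q ≈-refl) ≋-refl

  ⊗-assoc : ∀ p q r → (p ⊗ q) ⊗ r ≋ p ⊗ (q ⊗ r)
  ⊗-assoc []      q r = ≋-refl
  ⊗-assoc (a ∷ p) q r = begin
    (scale a q ⊕ (0# ∷ p ⊗ q)) ⊗ r
      ≈⟨ ⊗-distribʳ r (scale a q) (0# ∷ p ⊗ q) ⟩
    scale a q ⊗ r ⊕ (0# ∷ p ⊗ q) ⊗ r
      ≈⟨ ⊕-cong (scale-⊗ a q r) (≋-trans (shift-⊗ (p ⊗ q) r) (∷-cong ≈-refl (⊗-assoc p q r))) ⟩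
    scale a (q ⊗ r) ⊕ (0# ∷ p ⊗ (q ⊗ r))
      ∎

  ⊗-identityˡ : ∀ p → [ 1# ] ⊗ p ≋ p
  ⊗-identityˡ p = begin
    scale 1# p ⊕ (0# ∷ [])  ≈⟨ ⊕-cong (scale-one p) (∷-zero ≈-refl ≋-refl) ⟩
    p ⊕ []                  ≈⟨ ⊕-identityʳ p ⟩
    p                       ∎

  polynomialRing : CommutativeRing 0ℓ 0ℓ
  polynomialRing = record
    { Carrier = Poly
    ; _≈_ = _≋_
    ; _+_ = _⊕_
    ; _*_ = _⊗_
    ; -_  = ⊖_
    ; 0#  = []
    ; 1#  = [ 1# ]
    ; isCommutativeRing = record
      { isRing = record
        { +-isAbelianGroup = record
          { isGroup = record
            { isMonoid = record
              { isSemigroup = record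
                { isMagma = record
                  { isEquivalence = Setoid.isEquivalence ≋-setoid ; ∙-cong = ⊕-cong }
                ; assoc = ⊕-assoc }
              ; identity = (λ _ → ≋-refl) , ⊕-identityʳ }
            ; inverse = (λ p → ≋-trans (⊕-comm (⊖ p) p) (⊖-inverseʳ p)) , ⊖-inverseʳ
            ; ⁻¹-cong = ⊖-cong }
          ; comm = ⊕-comm }
        ; *-cong = ⊗-cong
        ; *-assoc = ⊗-assoc
        ; *-identity =
            ⊗-identityˡ , λ p → ≋-trans (⊗-comm p [ 1# ]) (⊗-identityˡ p)
        ; distrib = ⊗-distribˡ , ⊗-distribʳ }
      ; *-comm = ⊗-comm } }

  constant : Carrier → Poly
  constant a = [ a ]

  indeterminate : Poly
  indeterminate = 0# ∷ 1# ∷ []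

  zero? : (∀ a → Dec (a ≈ 0#)) → ∀ p → Dec (p ≋ [])
  zero? _≟0 p = map′ (fromAll p) (toAll p) (all? _≟0 p)
    where
    fromAll : ∀ q → All (_≈ 0#) q → q ≋ []
    fromAll []      []         = ≋-refl
    fromAll (a ∷ q) (a≈0 ∷ zs) = ∷-zero a≈0 (fromAll q zs)

    toAll : ∀ q → q ≋ [] → All (_≈ 0#) q
    toAll []      e = []
    toAll (a ∷ q) e = coeff≈ e 0 ∷ toAll q (∷-tail-zero e)

  noZeroDivisors : (∀ a b → a * b ≈ 0# → a ≈ 0# ⊎ b ≈ 0#) →
                   ∀ p q → p ⊗ q ≋ [] → p ≋ [] ⊎ q ≋ []
  noZeroDivisors domain []      q       e = inj₁ ≋-refl
  noZeroDivisors domain (a ∷ p) []      e = inj₂ ≋-refl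
  noZeroDivisors domain (a ∷ p) (b ∷ q) e =
    Sum.[ (λ a≈0 → Sum.map₁ (∷-zero a≈0) (noZeroDivisors domain p (b ∷ q) (left a≈0)))
        , (λ b≈0 → Sum.map₂ (∷-zero b≈0) (noZeroDivisors domain (a ∷ p) q (right b≈0)))
        ]′ (domain a b (≈-trans (≈-sym (+-identityʳ _)) (coeff≈ e 0)))
    where
    left : a ≈ 0# → p ⊗ (b ∷ q) ≋ []
    left a≈0 = ∷-tail-zero {0#} (begin
      (0# ∷ p ⊗ (b ∷ q))
        ≈⟨ ⊕-cong {q = 0# ∷ p ⊗ (b ∷ q)} (scale-zero (b ∷ q) a≈0) ≋-refl ⟨
      (a ∷ p) ⊗ (b ∷ q)   ≈⟨ e ⟩
      []                  ∎)

    right : b ≈ 0# → (a ∷ p) ⊗ q ≋ []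
    right b≈0 = ∷-tail-zero {0#} (begin
      (0# ∷ (a ∷ p) ⊗ q)
        ≈⟨ ⊕-cong {q = 0# ∷ (a ∷ p) ⊗ q} (scale-zero (a ∷ p) b≈0) ≋-refl ⟨
      scale b (a ∷ p) ⊕ (0# ∷ (a ∷ p) ⊗ q)
        ≈⟨ ⊗-∷ʳ (a ∷ p) b q ⟨
      (a ∷ p) ⊗ (b ∷ q)   ≈⟨ e ⟩
      []                  ∎)

------------------------------------------------------------------------

record IntegralDomain : Set₁ where
  field
    commutativeRing : CommutativeRing 0ℓ 0ℓ
  open CommutativeRing commutativeRing public
  field
    _≟0    : ∀ a → Dec (a ≈ 0#)
    1≉0    : ¬ (1# ≈ 0#)
    domain : ∀ a b → a * b ≈ 0# → a ≈ 0# ⊎ b ≈ 0#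

_[X] : IntegralDomain → IntegralDomain
D [X] = record
  { commutativeRing = polynomialRing
  ; _≟0    = zero? _≟0
  ; 1≉0    = λ e → 1≉0 (coeff≈ e 0)
  ; domain = noZeroDivisors domain
  }
  where
  open IntegralDomain D
  open Univariate commutativeRing

ℚ-domain : IntegralDomain
ℚ-domain = record
  { commutativeRing = ℚₚ.+-*-commutativeRing
  ; _≟0    = λ p → p ℚₚ.≟ 0ℚ
  ; 1≉0    = λ ()
  ; domain = dom
  }
  where
  dom : ∀ p q → p *ℚ q ≡ 0ℚ → p ≡ 0ℚ ⊎ q ≡ 0ℚ
  dom p q pq≡0 with p ℚₚ.≟ 0ℚ
  ... | yes p≡0 = inj₁ p≡0
  ... | no  p≢0 = inj₂
    (trans (sym (ℚₚ.*-identityˡ q))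
    (trans (cong (_*ℚ q) (sym (ℚₚ.*-inverseˡ p)))
    (trans (ℚₚ.*-assoc (1/ p) p q)
    (trans (cong (1/ p *ℚ_) pq≡0) (ℚₚ.*-zeroʳ (1/ p))))))
    where instance _ = ≢-nonZero p≢0

ℚ[x_] : ℕ → IntegralDomain
ℚ[x zero  ] = ℚ-domain
ℚ[x suc n ] = ℚ[x n ] [X]

Polynomial : ℕ → Set
Polynomial n = IntegralDomain.Carrier ℚ[x n ]

x : ∀ {n} → Fin n → Polynomial n
x {suc n} zero    = Univariate.indeterminate (IntegralDomain.commutativeRing ℚ[x n ])
x {suc n} (suc i) = Univariate.constant (IntegralDomain.commutativeRing ℚ[x n ]) (x i)

module FractionField (D : IntegralDomain) where

  open IntegralDomain D

  record Fraction : Set where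
    constructor mkFraction
    field
      numerator     : Carrier
      denominator   : Carrier
      denominator≉0 : ¬ (denominator ≈ 0#)
  open Fraction public

  infix 4 _≃_
  _≃_ : Rel Fraction 0ℓ
  f ≃ g = numerator f * denominator g ≈ numerator g * denominator f

  0ᶠ : Fraction
  0ᶠ = mkFraction 0# 1# 1≉0

  infixl 6 _+ᶠ_
  _+ᶠ_ : Fraction → Fraction → Fraction
  mkFraction a b b≉0 +ᶠ mkFraction c d d≉0 =
    mkFraction (a * d + c * b) (b * d) λ bd≈0 →
      Sum.[ b≉0 , d≉0 ]′ (domain b d bd≈0)

  -- The quotient a/b, with the usual convention that it is 0 when b is 0.
  infixl 7 _/_
  _/_ : Carrier → Carrier → Fraction
  a / b with b ≟0
  ... | yes _   = 0ᶠ
  ... | no b≉0 = mkFraction a b b≉0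

------------------------------------------------------------------------

infix 4 _⊢_⟶_
_⊢_⟶_ : ∀ {n} → (Fin n → Fin n → Bool) → Fin n → Fin n → Set
arc ⊢ i ⟶ j = T (arc i j)

-- Acyclicity already excludes loops and anti-parallel arcs.
record Quiver (n : ℕ) : Set where
  field
    arc     : Fin n → Fin n → Bool
    acyclic : ∀ i → ¬ TransClosure (arc ⊢_⟶_) i i

  infix 4 _⟶_
  _⟶_ : Rel (Fin n) 0ℓ
  i ⟶ j = arc ⊢ i ⟶ j

  IsSource IsSink : Pred (Fin n) 0ℓ
  IsSource k = ∀ i → ¬ (i ⟶ k)
  IsSink   k = ∀ j → ¬ (k ⟶ j)

module _ {n : ℕ} where
  open Quiver

  record FlipAt (k : Fin n) (Q Q′ : Quiver n) : Set where
    field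
      sourceOrSink : IsSource Q k ⊎ IsSink Q k
      reversed     : ∀ i j →
        arc Q′ i j ≡ (if ⌊ i ≟ k ⌋ ∨ ⌊ j ≟ k ⌋ then arc Q j i else arc Q i j)

  Flip : Rel (Quiver n) 0ℓ
  Flip Q Q′ = ∃[ k ] FlipAt k Q Q′

  -- A toric poset is represented by any of its members; the toric poset [Q]
  -- is the set of all Q′ with Q ∼ Q′.
  infix 4 _∼_
  _∼_ : Rel (Quiver n) 0ℓ
  _∼_ = Star Flip

------------------------------------------------------------------------

module _ {n : ℕ} (Q : Quiver n) where
  open Quiver Q using (_⟶_)

  data ToricPath : Fin n → Fin n → List (Fin n) → Set where
    vertex : ∀ i → ToricPath i i [ i ]
    path   : ∀ {i j} vs → let ws = i ∷ vs ∷ʳ j in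
             Unique ws → Linked _⟶_ ws → i ⟶ j → ToricPath i j ws

  pathLength : List (Fin n) → ℕ
  pathLength ws = length ws ∸ 1

  -- Containment is containment of directed paths, i.e. as a consecutive
  -- stretch.  Containment of vertex sets would be wrong: 1 → 2 → 5 must not
  -- count as contained in 1 → 2 → 4 → 5, or else the Hasse diagram would
  -- depend on the representative of the toric poset.
  IsMaximal : Pred (List (Fin n)) 0ℓ
  IsMaximal vs = ∀ {i j ws} → ToricPath i j ws → Infix _≡_ vs ws → vs ≡ ws

  HasseArc : Rel (Fin n) 0ℓ
  HasseArc i j = i ⟶ j × ¬ (∃[ vs ] ToricPath i j vs × ¬ IsMaximal vs × 1 <ⁿ pathLength vs)

  -- An edge {i , j} is represented by the pair with i < j.
  IsHasseEdge : Pred (Fin n × Fin n) 0ℓ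
  IsHasseEdge (i , j) = i <ᶠ j × (HasseArc i j ⊎ HasseArc j i)

------------------------------------------------------------------------

-- Dedekind cuts.
record ℝ : Set₁ where
  field
    Lower Upper     : Pred ℚ 0ℓ
    lower-inhabited : ∃ Lower
    upper-inhabited : ∃ Upper
    lower-rounded   : ∀ p → Lower p ⇔ (∃[ q ] p <ℚ q × Lower q)
    upper-rounded   : ∀ q → Upper q ⇔ (∃[ p ] p <ℚ q × Upper p)
    disjoint        : ∀ q → ¬ (Lower q × Upper q)
    located         : ∀ {p q} → p <ℚ q → Lower p ⊎ Upper q

infix 4 _<ᴿ_
_<ᴿ_ : Rel ℝ 0ℓ
a <ᴿ b = ∃[ q ] ℝ.Upper a q × ℝ.Lower b q

-- ℝ/ℤ, an element being given by its representative in [0,1).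
record ℝ/ℤ : Set₁ where
  field
    value   : ℝ
    0≤value : ¬ ℝ.Upper value 0ℚ
    value<1 : ℝ.Upper value 1ℚ

module _ {n : ℕ} where

  Point : Set₁
  Point = Fin n → ℝ/ℤ

  _⊨_≺_ : Point → Fin n → Fin n → Set
  p ⊨ i ≺ j = ℝ/ℤ.value (p i) <ᴿ ℝ/ℤ.value (p j)

  -- All members of [Q] have the same underlying graph, so a point satisfying
  -- this lies off the toric arrangement and Q′ is the orientation it induces.
  ToricChamber : Quiver n → Pred Point 0ℓ
  ToricChamber Q p = ∃[ Q′ ] Q ∼ Q′ × (∀ {i j} → Quiver._⟶_ Q′ i j → p ⊨ i ≺ j)

  IsTotalOrder : Pred (List (Fin n)) 0ℓ
  IsTotalOrder w = w ↭ allFin n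

  rotate : List (Fin n) → List (Fin n)
  rotate []      = []
  rotate (i ∷ w) = w ∷ʳ i

  -- The toric total order [w] is the set of all w′ with w ≈ᵗ w′.
  infix 4 _≈ᵗ_
  _≈ᵗ_ : Rel (List (Fin n)) 0ℓ
  _≈ᵗ_ = Star λ u v → v ≡ rotate u

  TotalOrderChamber : List (Fin n) → Pred Point 0ℓ
  TotalOrderChamber w p = ∃[ w′ ] w ≈ᵗ w′ × Linked (p ⊨_≺_) w′

  IsToricTotalExtension : Quiver n → Pred (List (Fin n)) _
  IsToricTotalExtension Q w =
    IsTotalOrder w × (∀ p → TotalOrderChamber w p → ToricChamber Q p)

------------------------------------------------------------------------

-- The list as contains exactly one member of each ≈-class of elements
-- satisfying P, and nothing else.
record Enumerates {a ℓ p} {A : Set a} (_≈_ : Rel A ℓ) (P : Pred A p) (as : List A)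
                  : Set (a ⊔ ℓ ⊔ p) where
  field
    sound       : All P as
    complete    : ∀ {b} → P b → Any (b ≈_) as
    irredundant : AllPairs (λ b c → ¬ (b ≈ c)) as

module RationalFunctions (n : ℕ) where

  open IntegralDomain ℚ[x n ] using (_*_; _-_; 1#)
  open FractionField ℚ[x n ] public

  difference : Fin n → Fin n → Polynomial n
  difference i j = x i - x j

  ∏ : List (Polynomial n) → Polynomial n
  ∏ = foldr _*_ 1#

  ∑ : List Fraction → Fraction
  ∑ = foldr _+ᶠ_ 0ᶠ

  -- Zipping w with its rotation gives the factors x_{w₁} - x_{w₂}, …,
  -- x_{wₙ} - x_{w₁}; for a total order w and n ≥ 2 their product is nonzero.
  Ψ-order : List (Fin n) → Fraction
  Ψ-order w = 1# / ∏ (zipWith difference w (rotate w))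

  -- Ψ of [Q], for ws a list enumerating the toric total extensions of [Q].
  Ψ : List (List (Fin n)) → Fraction
  Ψ ws = ∑ (map Ψ-order ws)

  edgeProduct : List (Fin n × Fin n) → Polynomial n
  edgeProduct es = ∏ (map (uncurry difference) es)

{-# OPTIONS --safe #-}
-- Multiply Ψ of [Q] by the product E of the Hasse edges. The denominator of Ψ
-- is a product of differences x_i - x_j, which are prime: the kernel of the
-- substitution σ : x_i ↦ x_j is generated by x_i - x_j. So E Ψ is a polynomial
-- as soon as it is regular along every hyperplane x_i = x_j, i.e. can be written
-- with a denominator that σ does not kill. Only cyclic orders w in which i and j
-- are neighbours have a pole there, a simple one, which E cancels if {i,j} is a
-- Hasse edge. If {i,j} is not an edge of Q, exchanging the neighbours i and j
-- permutes these w and the residues of w and its partner are opposite. If i → j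
-- is an arc outside the Hasse diagram, it spans a non-maximal toric path of
-- length > 1. A flip moves an end of a toric path to its other end, so the path
-- keeps its cyclic order in every toric extension; a vertex inside the arc and a
-- vertex of a longer path outside it then separate i from j on both sides, and
-- no w has a pole.
module Submission where

open import Algebra.Bundles using (CommutativeRing; CommutativeMonoid)
import Algebra.Morphism.Construct.Composition as Compose
import Algebra.Morphism.Construct.Identity as Identity
open import Algebra.Morphism.Structures using (module RingMorphisms)
import Algebra.Properties.AbelianGroup as AbelianGroupProperties
import Algebra.Properties.CommutativeSemigroup as CommutativeSemigroupProperties
import Algebra.Properties.Ring as RingProperties
import Algebra.Solver.Ring.NaturalCoefficients.Default as NaturalCoefficients
open import Data.Bool.Base using (Bool; if_then_else_; _∨_; T)
open import Data.Bool.Properties using (T?)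
open import Data.Fin.Base using (Fin; zero; suc)
open import Data.Fin.Permutation.Components using (transpose)
open import Data.Fin.Properties using (_≟_)
import Data.Fin.Properties as Fin
open import Data.List.Base
  using (List; []; _∷_; [_]; _++_; _∷ʳ_; map; zipWith; filter; length; allFin;
    InitLast; initLast; _∷ʳ′_)
import Data.List.Membership.DecPropositional as DecMembership
open import Data.List.Membership.Propositional using (_∈_; _∉_; find; lose)
open import Data.List.Membership.Propositional.Properties
  using (∈-∃++; ∈-allFin; ∈-++⁺ˡ; ∈-++⁺ʳ; ∈-filter⁺; ∈-map⁺)
import Data.List.Membership.Setoid as SetoidMembership
import Data.List.Membership.Setoid.Properties as SetoidMembershipₚ
import Data.List.Properties as List
import Data.List.Relation.Binary.Infix.Heterogeneous as Infix
open import Data.List.Relation.Binary.Permutation.Propositional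
  using (_↭_; ↭-sym; ↭-trans; ↭-swap; ↭⇒↭ₛ)
open import Data.List.Relation.Binary.Permutation.Propositional.Properties
  using (∈-resp-↭; ++-comm; ↭-length)
import Data.List.Relation.Binary.Permutation.Setoid as SetoidPermutation
import Data.List.Relation.Binary.Permutation.Setoid.Properties as SetoidPermutationₚ
open import Data.List.Relation.Binary.Pointwise using (Pointwise-≡⇒≡)
open import Data.List.Relation.Unary.All as All using (All; []; _∷_)
import Data.List.Relation.Unary.All.Properties as All
open import Data.List.Relation.Unary.AllPairs as AllPairs using (AllPairs; []; _∷_)
import Data.List.Relation.Unary.AllPairs.Properties as AllPairs
open import Data.List.Relation.Unary.Any using (here; there)
open import Data.List.Relation.Unary.Linked using (Linked; []; [-]; _∷_)
open import Data.List.Relation.Unary.Linked.Properties using (Linked⇒AllPairs; AllPairs⇒Linked)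
open import Data.List.Relation.Unary.Unique.Propositional using (Unique)
open import Data.List.Relation.Unary.Unique.Propositional.Properties using (allFin⁺; Unique[x∷xs]⇒x∉xs)
import Data.List.Relation.Unary.Unique.Setoid as SetoidUnique
open import Data.Nat.Base as ℕ using (ℕ; zero; suc; _≤_; _<_; s≤s; z<s; s<s)
import Data.Nat.Properties as ℕ
open import Data.Product using (Σ-syntax; ∃-syntax; _×_; _,_; proj₁; proj₂; swap; uncurry)
import Data.Product.Properties as Product
open import Data.Rational.Base using (ℚ; 0ℚ; 1ℚ) renaming (_<_ to _<ℚ_; _≤_ to _≤ℚ_; -_ to -ℚ_)
import Data.Rational.Properties as ℚ
open import Data.Sum.Base as Sum using (_⊎_; inj₁; inj₂; [_,_]′)
open import Function.Base using (_∘_)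
open import Function.Bundles using (mk⇔; Equivalence)
open import Level using (0ℓ)
open import Relation.Binary.Bundles using (Setoid)
open import Relation.Binary.Construct.Closure.ReflexiveTransitive using (ε; _◅_; _◅◅_; gmap)
open import Relation.Binary.Construct.Closure.Transitive using (TransClosure)
  renaming ([_] to [_]⁺; _∷_ to _∷⁺_)
open import Relation.Binary.Definitions using (tri<; tri≈; tri>)
open import Relation.Binary.PropositionalEquality as ≡
  using (_≡_; _≢_; refl; cong; cong₂; subst; subst₂; module ≡-Reasoning)
import Relation.Binary.Reasoning.Setoid as SetoidReasoning
open import Relation.Nullary.Decidable using (Dec; yes; no; ⌊_⌋; ¬?)
open import Relation.Nullary.Negation using (¬_; contradiction)
open import Defs

-- Polynomials

-- Divisibility is obtained without unique factorisation: regularity along x_i = x_j allows one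
-- factor x_i - x_j to be cancelled, and this property of a denominator passes to products
-- (`Cancellable`). With at least three vertices, i and j cannot be neighbours on both sides of a
-- cyclic order; this keeps the poles simple. For two vertices joined by an arc, Ψ is -1/(x_1 -
-- x_2)^2, which one edge factor cannot clear. For a non-edge no order is selected from each pair of
-- partners: exchanging i and j permutes the summands, so twice the sum is a sum over pairs, and 2
-- is invertible. Chambers enter the argument only through `TotalExtension`: some member of [Q] has
-- the order as a linear extension. Rotating the order flips that member at its first vertex, so
-- neighbours i and j can be put in the first two places. There i is a source and only i can have an
-- arc into j, which determines how a toric path passes through both.

module _ (R S : CommutativeRing 0ℓ 0ℓ) where
  private
    module R = CommutativeRing R
    module S = CommutativeRing S
  open RingMorphisms R.rawRing S.rawRing

  IsRingHom : (R.Carrier → S.Carrier) → Set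
  IsRingHom = IsRingHomomorphism

  -- Preservation of 0 and of negation follows from additivity, because the target is a group under
  -- addition.
  isRingHom : {φ : R.Carrier → S.Carrier} →
    (∀ {a b} → a R.≈ b → φ a S.≈ φ b) →
    (∀ a b → φ (a R.+ b) S.≈ φ a S.+ φ b) →
    (∀ a b → φ (a R.* b) S.≈ φ a S.* φ b) →
    φ R.1# S.≈ S.1# → IsRingHom φ
  isRingHom {φ} φ-cong φ-+ φ-* φ-1 = record
    { isSemiringHomomorphism = record
      { isNearSemiringHomomorphism = record
        { +-isMonoidHomomorphism = record
          { isMagmaHomomorphism = record
            { isRelHomomorphism = record { cong = φ-cong }
            ; homo = φ-+ }
          ; ε-homo = φ-0 }
        ; *-homo = φ-* }
      ; 1#-homo = φ-1 }
    ; -‿homo = λ a → inverseˡ-unique (φ (R.- a)) (φ a)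
        (S.trans (S.sym (φ-+ (R.- a) a)) (S.trans (φ-cong (R.-‿inverseˡ a)) φ-0)) }
    where
    open AbelianGroupProperties S.+-abelianGroup
    φ-0 : φ R.0# S.≈ S.0#
    φ-0 = identityʳ-unique (φ R.0#) (φ R.0#)
      (S.trans (S.sym (φ-+ R.0# R.0#)) (φ-cong (R.+-identityʳ R.0#)))

module UnivariateEvaluation (R S : CommutativeRing 0ℓ 0ℓ)
  {φ : CommutativeRing.Carrier R → CommutativeRing.Carrier S}
  (φ-hom : IsRingHom R S φ) (s : CommutativeRing.Carrier S) where

  private
    module R = CommutativeRing R
    module φ = RingMorphisms.IsRingHomomorphism φ-hom
  open CommutativeRing S hiding (zero) renaming (refl to ≈-refl; sym to ≈-sym; trans to ≈-trans)
  open NaturalCoefficients commutativeSemiring using (solve; _:+_; _:*_; _:=_)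
  open Univariate R
  open SetoidReasoning setoid

  evaluate : Poly → Carrier
  evaluate []      = 0#
  evaluate (a ∷ p) = φ a + s * evaluate p

  private
    extend-zero : ∀ {a v} → a ≈ 0# → v ≈ 0# → a + s * v ≈ 0#
    extend-zero {a} {v} a≈0 v≈0 = begin
      a + s * v    ≈⟨ +-cong a≈0 (≈-trans (*-congˡ v≈0) (zeroʳ s)) ⟩
      0# + 0#      ≈⟨ +-identityʳ 0# ⟩
      0#           ∎

    -- Zero has representatives of every length, so that evaluation respects `_≋_` across different
    -- lengths rests on this case.
    evaluate-zero : ∀ p → p ≋ [] → evaluate p ≈ 0#
    evaluate-zero []      e = ≈-refl
    evaluate-zero (a ∷ p) e = extend-zero
      (≈-trans (φ.⟦⟧-cong (coeff≈ e 0)) φ.0#-homo) (evaluate-zero p (∷-tail-zero e))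

    evaluate-cong : ∀ p q → p ≋ q → evaluate p ≈ evaluate q
    evaluate-cong []      q       e = ≈-sym (evaluate-zero q (≋-sym e))
    evaluate-cong (a ∷ p) []      e = evaluate-zero (a ∷ p) e
    evaluate-cong (a ∷ p) (b ∷ q) e =
      +-cong (φ.⟦⟧-cong (coeff≈ e 0)) (*-congˡ (evaluate-cong p q (∷-tail e)))

    evaluate-⊕ : ∀ p q → evaluate (p ⊕ q) ≈ evaluate p + evaluate q
    evaluate-⊕ []      q       = ≈-sym (+-identityˡ _)
    evaluate-⊕ (a ∷ p) []      = ≈-sym (+-identityʳ _)
    evaluate-⊕ (a ∷ p) (b ∷ q) = begin
      φ (a R.+ b) + s * evaluate (p ⊕ q)
        ≈⟨ +-cong (φ.+-homo a b) (*-congˡ (evaluate-⊕ p q)) ⟩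
      (φ a + φ b) + s * (evaluate p + evaluate q)
        ≈⟨ lemma (φ a) (φ b) s (evaluate p) (evaluate q) ⟩
      (φ a + s * evaluate p) + (φ b + s * evaluate q) ∎
      where
      lemma : ∀ a b s u v → (a + b) + s * (u + v) ≈ (a + s * u) + (b + s * v)
      lemma = solve 5 (λ a b s u v →
        (a :+ b) :+ s :* (u :+ v) := (a :+ s :* u) :+ (b :+ s :* v)) ≈-refl

    evaluate-scale : ∀ a p → evaluate (scale a p) ≈ φ a * evaluate p
    evaluate-scale a []      = ≈-sym (zeroʳ (φ a))
    evaluate-scale a (b ∷ p) = begin
      φ (a R.* b) + s * evaluate (scale a p)
        ≈⟨ +-cong (φ.*-homo a b) (*-congˡ (evaluate-scale a p)) ⟩
      φ a * φ b + s * (φ a * evaluate p)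
        ≈⟨ lemma (φ a) (φ b) s (evaluate p) ⟩
      φ a * (φ b + s * evaluate p) ∎
      where
      lemma : ∀ a b s u → a * b + s * (a * u) ≈ a * (b + s * u)
      lemma = solve 4 (λ a b s u →
        a :* b :+ s :* (a :* u) := a :* (b :+ s :* u)) ≈-refl

    evaluate-⊗ : ∀ p q → evaluate (p ⊗ q) ≈ evaluate p * evaluate q
    evaluate-⊗ []      q = ≈-sym (zeroˡ _)
    evaluate-⊗ (a ∷ p) q = begin
      evaluate (scale a q ⊕ (R.0# ∷ p ⊗ q))
        ≈⟨ evaluate-⊕ (scale a q) (R.0# ∷ p ⊗ q) ⟩
      evaluate (scale a q) + (φ R.0# + s * evaluate (p ⊗ q))
        ≈⟨ +-cong (evaluate-scale a q) (+-cong φ.0#-homo (*-congˡ (evaluate-⊗ p q))) ⟩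
      φ a * evaluate q + (0# + s * (evaluate p * evaluate q))
        ≈⟨ +-congˡ (+-identityˡ _) ⟩
      φ a * evaluate q + s * (evaluate p * evaluate q)
        ≈⟨ lemma (φ a) s (evaluate p) (evaluate q) ⟩
      (φ a + s * evaluate p) * evaluate q ∎
      where
      lemma : ∀ a s u v → a * v + s * (u * v) ≈ (a + s * u) * v
      lemma = solve 4 (λ a s u v →
        a :* v :+ s :* (u :* v) := (a :+ s :* u) :* v) ≈-refl

  evaluate-constant : ∀ a → evaluate (constant a) ≈ φ a
  evaluate-constant a = ≈-trans (+-congˡ (zeroʳ s)) (+-identityʳ (φ a))

  evaluate-indeterminate : evaluate indeterminate ≈ s
  evaluate-indeterminate = begin
    φ R.0# + s * (φ R.1# + s * 0#)
      ≈⟨ +-cong φ.0#-homo (*-congˡ (≈-trans (+-cong φ.1#-homo (zeroʳ s)) (+-identityʳ 1#))) ⟩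
    0# + s * 1#                    ≈⟨ ≈-trans (+-identityˡ _) (*-identityʳ s) ⟩
    s                              ∎

  evaluate-isRingHom : IsRingHom polynomialRing S evaluate
  evaluate-isRingHom = isRingHom polynomialRing S
    (λ {p} {q} → evaluate-cong p q) evaluate-⊕ evaluate-⊗
    (≈-trans (evaluate-constant R.1#) φ.1#-homo)

module _ (R : CommutativeRing 0ℓ 0ℓ) where
  open CommutativeRing R hiding (zero) renaming (refl to ≈-refl; sym to ≈-sym; trans to ≈-trans)
  open Univariate R

  constant-isRingHom : IsRingHom R polynomialRing constant
  constant-isRingHom = isRingHom R polynomialRing
    (λ a≈b → ∷-cong a≈b ≋-refl) (λ _ _ → ≋-refl)
    (λ a b → ∷-cong (≈-sym (+-identityʳ _)) ≋-refl) ≋-refl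

  -- The Horner step: it determines a ring homomorphism by its values on constants and on the
  -- indeterminate.
  ∷-constant : ∀ a p → (a ∷ p) ≋ constant a ⊕ indeterminate ⊗ p
  ∷-constant a p = ≋-sym (≋-trans (⊕-cong (≋-refl {constant a}) X⊗p)
    (∷-cong (+-identityʳ a) ≋-refl))
    where
    X⊗p : indeterminate ⊗ p ≋ (0# ∷ p)
    X⊗p = ≋-trans (shift-⊗ [ 1# ] p) (∷-cong ≈-refl (⊗-identityˡ p))

ℚ[x_]ʳ : ℕ → CommutativeRing 0ℓ 0ℓ
ℚ[x n ]ʳ = IntegralDomain.commutativeRing ℚ[x n ]

ι : ∀ n → ℚ → Polynomial n
ι zero    q = q
ι (suc n) q = Univariate.constant ℚ[x n ]ʳ (ι n q)

ι-isRingHom : ∀ n → IsRingHom ℚ[x 0 ]ʳ ℚ[x n ]ʳ (ι n)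
ι-isRingHom zero    = Identity.isRingHomomorphism _ (CommutativeRing.refl ℚ[x 0 ]ʳ)
ι-isRingHom (suc n) = Compose.isRingHomomorphism
  (λ {p} {q} {r} → Univariate.≋-trans ℚ[x n ]ʳ {p} {q} {r})
  (ι-isRingHom n) (constant-isRingHom ℚ[x n ]ʳ)

module Evaluation (S : CommutativeRing 0ℓ 0ℓ)
  {κ : ℚ → CommutativeRing.Carrier S} (κ-hom : IsRingHom ℚ[x 0 ]ʳ S κ) where
  open CommutativeRing S hiding (zero) renaming (refl to ≈-refl; sym to ≈-sym; trans to ≈-trans)

  -- Polynomials are iterated univariate ones, so adding a variable needs the evaluation of the
  -- coefficients to be a homomorphism already; hence the mutual definition.
  evaluate : ∀ n → (Fin n → Carrier) → Polynomial n → Carrier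
  evaluate-isRingHom : ∀ n (θ : Fin n → Carrier) → IsRingHom ℚ[x n ]ʳ S (evaluate n θ)

  evaluate zero    θ = κ
  evaluate (suc n) θ =
    UnivariateEvaluation.evaluate ℚ[x n ]ʳ S (evaluate-isRingHom n (θ ∘ suc)) (θ zero)

  evaluate-isRingHom zero    θ = κ-hom
  evaluate-isRingHom (suc n) θ =
    UnivariateEvaluation.evaluate-isRingHom ℚ[x n ]ʳ S (evaluate-isRingHom n (θ ∘ suc)) (θ zero)

  evaluate-x : ∀ n (θ : Fin n → Carrier) i → evaluate n θ (x i) ≈ θ i
  evaluate-x (suc n) θ zero    =
    UnivariateEvaluation.evaluate-indeterminate ℚ[x n ]ʳ S (evaluate-isRingHom n (θ ∘ suc)) (θ zero)
  evaluate-x (suc n) θ (suc i) = ≈-trans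
    (UnivariateEvaluation.evaluate-constant ℚ[x n ]ʳ S (evaluate-isRingHom n (θ ∘ suc)) (θ zero) (x i))
    (evaluate-x n (θ ∘ suc) i)

  evaluate-ι : ∀ n (θ : Fin n → Carrier) q → evaluate n θ (ι n q) ≈ κ q
  evaluate-ι zero    θ q = ≈-refl
  evaluate-ι (suc n) θ q = ≈-trans
    (UnivariateEvaluation.evaluate-constant ℚ[x n ]ʳ S (evaluate-isRingHom n (θ ∘ suc)) (θ zero) (ι n q))
    (evaluate-ι n (θ ∘ suc) q)

-- Congruence modulo a principal ideal, and the kernel of the substitution σ

module Congruence (S : CommutativeRing 0ℓ 0ℓ) (d : CommutativeRing.Carrier S) where
  open CommutativeRing S hiding (zero) renaming (refl to ≈-refl; sym to ≈-sym; trans to ≈-trans)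
  open SetoidReasoning setoid
  open NaturalCoefficients commutativeSemiring using (solve; _:+_; _:*_; _:=_)

  infix 4 _≡ᵈ_
  _≡ᵈ_ : Carrier → Carrier → Set
  a ≡ᵈ b = ∃[ e ] a ≈ b + e * d

  ≈⇒≡ᵈ : ∀ {a b} → a ≈ b → a ≡ᵈ b
  ≈⇒≡ᵈ a≈b = 0# , ≈-trans a≈b (≈-sym (≈-trans (+-congˡ (zeroˡ d)) (+-identityʳ _)))

  ≡ᵈ-resp : ∀ {a a′ b b′} → a ≈ a′ → b ≈ b′ → a ≡ᵈ b → a′ ≡ᵈ b′
  ≡ᵈ-resp a≈a′ b≈b′ (e , a≈) = e , ≈-trans (≈-sym a≈a′) (≈-trans a≈ (+-congʳ b≈b′))

  +-≡ᵈ : ∀ {a a′ b b′} → a ≡ᵈ b → a′ ≡ᵈ b′ → a + a′ ≡ᵈ b + b′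
  +-≡ᵈ {b = b} {b′} (e , a≈) (e′ , a′≈) =
    e + e′ , ≈-trans (+-cong a≈ a′≈) (lemma b b′ e e′ d)
    where
    lemma : ∀ b b′ e e′ d → (b + e * d) + (b′ + e′ * d) ≈ b + b′ + (e + e′) * d
    lemma = solve 5 (λ b b′ e e′ d →
      (b :+ e :* d) :+ (b′ :+ e′ :* d) := b :+ b′ :+ (e :+ e′) :* d) ≈-refl

  *-≡ᵈ : ∀ {a a′ b b′} → a ≡ᵈ b → a′ ≡ᵈ b′ → a * a′ ≡ᵈ b * b′
  *-≡ᵈ {b = b} {b′} (e , a≈) (e′ , a′≈) =
    b * e′ + e * b′ + e * e′ * d , ≈-trans (*-cong a≈ a′≈) (lemma b b′ e e′ d)
    where
    lemma : ∀ b b′ e e′ d →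
      (b + e * d) * (b′ + e′ * d) ≈ b * b′ + (b * e′ + e * b′ + e * e′ * d) * d
    lemma = solve 5 (λ b b′ e e′ d →
      (b :+ e :* d) :* (b′ :+ e′ :* d) := b :* b′ :+ (b :* e′ :+ e :* b′ :+ e :* e′ :* d) :* d) ≈-refl

  -- Congruence modulo d is compatible with sums and products, and these build every polynomial from
  -- scalars and variables. The use is φ the identity, ψ = σ and d = x_i - x_j.
  ringHoms-≡ᵈ : ∀ n {φ ψ : Polynomial n → Carrier} →
    IsRingHom ℚ[x n ]ʳ S φ → IsRingHom ℚ[x n ]ʳ S ψ →
    (∀ q → φ (ι n q) ≡ᵈ ψ (ι n q)) → (∀ i → φ (x {n} i) ≡ᵈ ψ (x {n} i)) → ∀ p → φ p ≡ᵈ ψ p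
  ringHoms-≡ᵈ zero    φ-hom ψ-hom agreeᶜ agreeˣ p = agreeᶜ p
  ringHoms-≡ᵈ (suc n) {φ} {ψ} φ-hom ψ-hom agreeᶜ agreeˣ = go
    where
    module φ = RingMorphisms.IsRingHomomorphism φ-hom
    module ψ = RingMorphisms.IsRingHomomorphism ψ-hom
    open Univariate ℚ[x n ]ʳ

    onConstants : ∀ a → φ (constant a) ≡ᵈ ψ (constant a)
    onConstants = ringHoms-≡ᵈ n
      (Compose.isRingHomomorphism ≈-trans (constant-isRingHom ℚ[x n ]ʳ) φ-hom)
      (Compose.isRingHomomorphism ≈-trans (constant-isRingHom ℚ[x n ]ʳ) ψ-hom)
      agreeᶜ (agreeˣ ∘ suc)

    expand : ∀ {χ} → IsRingHom polynomialRing S χ → ∀ a p →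
      χ (a ∷ p) ≈ χ (constant a) + χ indeterminate * χ p
    expand {χ} χ-hom a p = begin
      χ (a ∷ p)                                ≈⟨ χ.⟦⟧-cong (∷-constant ℚ[x n ]ʳ a p) ⟩
      χ (constant a ⊕ indeterminate ⊗ p)       ≈⟨ χ.+-homo _ _ ⟩
      χ (constant a) + χ (indeterminate ⊗ p)   ≈⟨ +-congˡ (χ.*-homo _ _) ⟩
      χ (constant a) + χ indeterminate * χ p   ∎
      where module χ = RingMorphisms.IsRingHomomorphism χ-hom

    go : ∀ p → φ p ≡ᵈ ψ p
    go []      = ≈⇒≡ᵈ (≈-trans φ.0#-homo (≈-sym ψ.0#-homo))
    go (a ∷ p) = ≡ᵈ-resp (≈-sym (expand φ-hom a p)) (≈-sym (expand ψ-hom a p))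
      (+-≡ᵈ (onConstants a) (*-≡ᵈ (agreeˣ zero) (go p)))

-- The degree-one coefficient in the outermost variable is 1 for `x zero` and 0 for all other
-- variables.
x-injective : ∀ {n} {i j : Fin n} → IntegralDomain._≈_ ℚ[x n ] (x i) (x j) → i ≡ j
x-injective {suc n} {zero}  {zero}  e = refl
x-injective {suc n} {zero}  {suc j} e =
  contradiction (Univariate.coeff≈ e 1) (IntegralDomain.1≉0 ℚ[x n ])
x-injective {suc n} {suc i} {zero}  e =
  contradiction (CommutativeRing.sym ℚ[x n ]ʳ (Univariate.coeff≈ e 1)) (IntegralDomain.1≉0 ℚ[x n ])
x-injective {suc n} {suc i} {suc j} e = ≡.cong suc (x-injective (Univariate.coeff≈ e 0))

1+1≉0 : ∀ n → let open IntegralDomain ℚ[x n ] in ¬ (1# + 1# ≈ 0#)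
1+1≉0 zero    = λ ()
1+1≉0 (suc n) e = 1+1≉0 n (Univariate.coeff≈ e 0)

module Merge {n : ℕ} (i j : Fin n) where
  open IntegralDomain ℚ[x n ] hiding (zero) renaming (refl to ≈-refl; sym to ≈-sym; trans to ≈-trans)
  open RationalFunctions n using (difference)
  open Evaluation ℚ[x n ]ʳ (ι-isRingHom n)
  open Congruence ℚ[x n ]ʳ (difference i j)
  open SetoidReasoning setoid

  merge : Fin n → Fin n
  merge k with k ≟ i
  ... | yes _ = j
  ... | no  _ = k

  merge-i : merge i ≡ j
  merge-i with i ≟ i
  ... | yes _   = refl
  ... | no  i≢i = contradiction refl i≢i

  merge-other : ∀ {k} → k ≢ i → merge k ≡ k
  merge-other {k} k≢i with k ≟ i
  ... | yes k≡i = contradiction k≡i k≢i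
  ... | no  _   = refl

  σ : Polynomial n → Polynomial n
  σ = evaluate n (x ∘ merge)

  σ-isRingHom : IsRingHom ℚ[x n ]ʳ ℚ[x n ]ʳ σ
  σ-isRingHom = evaluate-isRingHom n (x ∘ merge)

  σ-x : ∀ k → σ (x k) ≈ x (merge k)
  σ-x = evaluate-x n (x ∘ merge)

  -- The identity and σ agree modulo x_i - x_j on scalars and variables, hence everywhere; so p is
  -- congruent to σ p, which is 0.
  σ-kernel : ∀ p → σ p ≈ 0# → ∃[ e ] p ≈ e * difference i j
  σ-kernel p σp≈0 with ringHoms-≡ᵈ n (Identity.isRingHomomorphism _ ≈-refl) σ-isRingHom
      (λ q → ≈⇒≡ᵈ (≈-sym (evaluate-ι n (x ∘ merge) q))) onVariables p
    where
    x≡ᵈx-merge : ∀ k → x k ≡ᵈ x (merge k)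
    x≡ᵈx-merge k with k ≟ i
    ... | no  _    = ≈⇒≡ᵈ ≈-refl
    ... | yes refl = 1# , (begin
      x i                          ≈⟨ +-identityʳ (x i) ⟨
      x i + 0#                     ≈⟨ +-congˡ (-‿inverseˡ (x j)) ⟨
      x i + (- x j + x j)          ≈⟨ +-assoc (x i) (- x j) (x j) ⟨
      (x i - x j) + x j            ≈⟨ +-comm _ (x j) ⟩
      x j + (x i - x j)            ≈⟨ +-congˡ (*-identityˡ _) ⟨
      x j + 1# * (x i - x j)       ∎)

    onVariables : ∀ k → x k ≡ᵈ σ (x k)
    onVariables k = ≡ᵈ-resp ≈-refl (≈-sym (σ-x k)) (x≡ᵈx-merge k)
  ... | e , p≈ = e , ≈-trans p≈ (≈-trans (+-congʳ σp≈0) (+-identityˡ _))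

-- Fractions

module _ {a ℓ} (S : Setoid a ℓ) where
  open Setoid S renaming (Carrier to A; refl to ≈-refl; sym to ≈-sym; trans to ≈-trans)
  open SetoidMembership S using () renaming (_∈_ to _∈ₛ_)
  open SetoidPermutation S using (↭-refl; ↭-prep; ↭-transˡ-≋)
    renaming (_↭_ to _↭ₛ_; ↭-sym to ↭ₛ-sym; ↭-trans to ↭ₛ-trans)
  open SetoidPermutationₚ S using (shift)
    renaming (∈-resp-↭ to ∈-resp-↭ₛ; Unique-resp-↭ to Unique-resp-↭ₛ)
  open SetoidUnique S using () renaming (Unique to Uniqueₛ)

  private
    ∷-⊆⁻ : ∀ {z zs ws} → All (λ y → ¬ (z ≈ y)) zs → (∀ {v} → v ∈ₛ zs → v ∈ₛ z ∷ ws) →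
           ∀ {v} → v ∈ₛ zs → v ∈ₛ ws
    ∷-⊆⁻ (z≉ ∷ _) ⊆ (here v≈) with ⊆ (here v≈)
    ... | here v≈z  = contradiction (≈-trans (≈-sym v≈z) v≈) z≉
    ... | there v∈  = v∈
    ∷-⊆⁻ (_ ∷ z≉) ⊆ (there v∈) = ∷-⊆⁻ z≉ (λ u∈ → ⊆ (there u∈)) v∈

  unique∧⊆⊇⇒↭ : ∀ {xs ys} → Uniqueₛ xs → Uniqueₛ ys →
    (∀ {v} → v ∈ₛ xs → v ∈ₛ ys) → (∀ {v} → v ∈ₛ ys → v ∈ₛ xs) → xs ↭ₛ ys
  unique∧⊆⊇⇒↭ {[]}     {[]}     _ _ _ _ = ↭-refl
  unique∧⊆⊇⇒↭ {[]}     {y ∷ ys} _ _ _ ⊇ = contradiction (⊇ (here ≈-refl)) λ ()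
  unique∧⊆⊇⇒↭ {z ∷ xs} {ys} (z≉ ∷ xs!) ys! ⊆ ⊇
    with ys₁ , ys₂ , w , z≈w , ys≋ ← SetoidMembershipₚ.∈-∃++ S (⊆ (here ≈-refl)) =
    ↭ₛ-trans (↭-prep z (unique∧⊆⊇⇒↭ xs! (AllPairs.tail rest!)
      (∷-⊆⁻ z≉ (λ v∈ → ∈-resp-↭ₛ ys↭ (⊆ (there v∈))))
      (∷-⊆⁻ (AllPairs.head rest!) (λ v∈ → ⊇ (∈-resp-↭ₛ (↭ₛ-sym ys↭) (there v∈))))))
      (↭ₛ-sym ys↭)
    where
    ys↭ : ys ↭ₛ z ∷ (ys₁ ++ ys₂)
    ys↭ = ↭-transˡ-≋ ys≋ (shift (≈-sym z≈w) ys₁ ys₂)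
    rest! : Uniqueₛ (z ∷ (ys₁ ++ ys₂))
    rest! = Unique-resp-↭ₛ ys↭ ys!

  -- An involution is injective, so the image list has no repetition either, and closure under f
  -- gives both inclusions. The setoid is needed because the lists hold representatives of rotation
  -- classes, and f need not send a listed representative to a listed one.
  unique∧involution⇒↭map : ∀ {f : A → A} → (∀ {u v} → u ≈ v → f u ≈ f v) → (∀ v → f (f v) ≈ v) →
    ∀ {xs} → Uniqueₛ xs → All (λ v → f v ∈ₛ xs) xs → xs ↭ₛ map f xs
  unique∧involution⇒↭map {f} f-cong involutive {xs} xs! closed = unique∧⊆⊇⇒↭ xs! fxs! ⊆ ⊇
    where
    fxs! : Uniqueₛ (map f xs)
    fxs! = AllPairs.map⁺ (AllPairs.map (λ {u} {v} u≉v fu≈fv → u≉v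
      (≈-trans (≈-sym (involutive u)) (≈-trans (f-cong fu≈fv) (involutive v)))) xs!)
    ⊆ : ∀ {v} → v ∈ₛ xs → v ∈ₛ map f xs
    ⊆ = All.lookupWith (λ {y} fy∈ v≈y → SetoidMembershipₚ.∈-resp-≈ S
      (≈-trans (involutive y) (≈-sym v≈y)) (SetoidMembershipₚ.∈-map⁺ S S f-cong fy∈)) closed
    ⊇ : ∀ {v} → v ∈ₛ map f xs → v ∈ₛ xs
    ⊇ v∈ = let _ , u∈ , v≈fu = SetoidMembershipₚ.∈-map⁻ S S v∈ in
      All.lookupWith (λ fy∈ u≈y → SetoidMembershipₚ.∈-resp-≈ S
        (≈-sym (≈-trans v≈fu (f-cong u≈y))) fy∈) closed u∈

-- The additive monoid of fractions

module Fractions (D : IntegralDomain) where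

  open IntegralDomain D renaming (refl to ≈-refl; sym to ≈-sym; trans to ≈-trans)
  open FractionField D
  open AbelianGroupProperties +-abelianGroup using (x∙y⁻¹≈ε⇒x≈y)
  open RingProperties ring using (-‿distribˡ-*)
  open SetoidReasoning setoid
  open NaturalCoefficients commutativeSemiring using (solve; _:+_; _:*_; _:=_; con)

  *-cancelʳ : ∀ {a b c} → ¬ (c ≈ 0#) → a * c ≈ b * c → a ≈ b
  *-cancelʳ {a} {b} {c} c≉0 ac≈bc =
    [ x∙y⁻¹≈ε⇒x≈y a b , (λ c≈0 → contradiction c≈0 c≉0) ]′ (domain (a - b) c (begin
      (a - b) * c           ≈⟨ distribʳ c a (- b) ⟩
      a * c + - b * c       ≈⟨ +-cong ac≈bc (≈-sym (-‿distribˡ-* b c)) ⟩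
      b * c - b * c         ≈⟨ -‿inverseʳ (b * c) ⟩
      0#                    ∎))

  *-≉0 : ∀ {a b} → ¬ (a ≈ 0#) → ¬ (b ≈ 0#) → ¬ (a * b ≈ 0#)
  *-≉0 {a} {b} a≉0 b≉0 ab≈0 = [ a≉0 , b≉0 ]′ (domain a b ab≈0)

  module _ {a b : Carrier} (b≉0 : ¬ (b ≈ 0#)) where

    /-numerator : numerator (a / b) ≈ a
    /-numerator with b ≟0
    ... | yes b≈0 = contradiction b≈0 b≉0
    ... | no  _   = ≈-refl

    /-denominator : denominator (a / b) ≈ b
    /-denominator with b ≟0
    ... | yes b≈0 = contradiction b≈0 b≉0
    ... | no  _   = ≈-refl

  /-congˡ : ∀ {a b b′} → b ≈ b′ → a / b ≃ a / b′
  /-congˡ {a} {b} {b′} b≈b′ with b ≟0 | b′ ≟0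
  ... | yes _   | yes _    = ≈-refl
  ... | yes b≈0 | no b′≉0  = contradiction (≈-trans (≈-sym b≈b′) b≈0) b′≉0
  ... | no b≉0  | yes b′≈0 = contradiction (≈-trans b≈b′ b′≈0) b≉0
  ... | no _    | no _     = *-congˡ (≈-sym b≈b′)

  ≃-trans : ∀ {f g h} → f ≃ g → g ≃ h → f ≃ h
  ≃-trans {mkFraction a b _} {mkFraction c d d≉0} {mkFraction e f _} ad≈cb cf≈ed =
    *-cancelʳ d≉0 (begin
      a * f * d     ≈⟨ solve 3 (λ a f d → a :* f :* d := a :* d :* f) ≈-refl a f d ⟩
      a * d * f     ≈⟨ *-congʳ ad≈cb ⟩
      c * b * f     ≈⟨ solve 3 (λ c b f → c :* b :* f := c :* f :* b) ≈-refl c b f ⟩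
      c * f * b     ≈⟨ *-congʳ cf≈ed ⟩
      e * d * b     ≈⟨ solve 3 (λ e d b → e :* d :* b := e :* b :* d) ≈-refl e d b ⟩
      e * b * d     ∎)

  +ᶠ-cong : ∀ {f f′ g g′} → f ≃ f′ → g ≃ g′ → f +ᶠ g ≃ f′ +ᶠ g′
  +ᶠ-cong {mkFraction a b _} {mkFraction a′ b′ _} {mkFraction c d _} {mkFraction c′ d′ _} e e′ =
    begin
      (a * d + c * b) * (b′ * d′)
        ≈⟨ solve 6 (λ a b c d b′ d′ → (a :* d :+ c :* b) :* (b′ :* d′) :=
             a :* b′ :* (d :* d′) :+ c :* d′ :* (b :* b′)) ≈-refl a b c d b′ d′ ⟩
      a * b′ * (d * d′) + c * d′ * (b * b′)
        ≈⟨ +-cong (*-congʳ e) (*-congʳ e′) ⟩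
      a′ * b * (d * d′) + c′ * d * (b * b′)
        ≈⟨ solve 6 (λ a b c d b′ d′ → a :* b :* (d :* d′) :+ c :* d :* (b :* b′) :=
             (a :* d′ :+ c :* b′) :* (b :* d)) ≈-refl a′ b c′ d b′ d′ ⟩
      (a′ * d′ + c′ * b′) * (b * d) ∎

  +ᶠ-assoc : ∀ f g h → (f +ᶠ g) +ᶠ h ≃ f +ᶠ (g +ᶠ h)
  +ᶠ-assoc (mkFraction a b _) (mkFraction c d _) (mkFraction e f _) =
    solve 6 (λ a b c d e f →
      ((a :* d :+ c :* b) :* f :+ e :* (b :* d)) :* (b :* (d :* f)) :=
      (a :* (d :* f) :+ (c :* f :+ e :* d) :* b) :* ((b :* d) :* f)) ≈-refl a b c d e f

  +ᶠ-comm : ∀ f g → f +ᶠ g ≃ g +ᶠ f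
  +ᶠ-comm (mkFraction a b _) (mkFraction c d _) =
    solve 4 (λ a b c d → (a :* d :+ c :* b) :* (d :* b) := (c :* b :+ a :* d) :* (b :* d))
      ≈-refl a b c d

  +ᶠ-identityˡ : ∀ f → 0ᶠ +ᶠ f ≃ f
  +ᶠ-identityˡ (mkFraction a b _) =
    solve 2 (λ a b → (con 0 :* b :+ a :* con 1) :* b := a :* (con 1 :* b)) ≈-refl a b

  +ᶠ-commutativeMonoid : CommutativeMonoid 0ℓ 0ℓ
  +ᶠ-commutativeMonoid = record
    { Carrier = Fraction ; _≈_ = _≃_ ; _∙_ = _+ᶠ_ ; ε = 0ᶠ
    ; isCommutativeMonoid = record
      { isMonoid = record
        { isSemigroup = record
          { isMagma = record
            { isEquivalence = record
              { refl = ≈-refl ; sym = ≈-sym ; trans = λ {f} {g} {h} → ≃-trans {f} {g} {h} }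
            ; ∙-cong = λ {f} {f′} {g} {g′} → +ᶠ-cong {f} {f′} {g} {g′} }
          ; assoc = +ᶠ-assoc }
        ; identity = +ᶠ-identityˡ , λ f →
            ≃-trans {f +ᶠ 0ᶠ} {0ᶠ +ᶠ f} {f} (+ᶠ-comm f 0ᶠ) (+ᶠ-identityˡ f) }
      ; comm = +ᶠ-comm } }

-- Regularity at the prime ideal ker σ

module Regularity (D : IntegralDomain)
  {σ : IntegralDomain.Carrier D → IntegralDomain.Carrier D}
  (σ-hom : IsRingHom (IntegralDomain.commutativeRing D) (IntegralDomain.commutativeRing D) σ) where

  open IntegralDomain D renaming (refl to ≈-refl; sym to ≈-sym; trans to ≈-trans)
  open FractionField D
  open Fractions D
  open SetoidReasoning setoid
  open NaturalCoefficients commutativeSemiring using (solve; _:+_; _:*_; _:=_; con)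
  private module σ = RingMorphisms.IsRingHomomorphism σ-hom

  -- c/b lies in the localisation at the prime ideal ker σ.
  Regular : Carrier → Carrier → Set
  Regular c b = ∃[ a′ ] ∃[ b′ ] ¬ (σ b′ ≈ 0#) × c * b′ ≈ a′ * b

  σ-*-≉0 : ∀ {a b} → ¬ (σ a ≈ 0#) → ¬ (σ b ≈ 0#) → ¬ (σ (a * b) ≈ 0#)
  σ-*-≉0 {a} {b} σa≉0 σb≉0 e = *-≉0 σa≉0 σb≉0 (≈-trans (≈-sym (σ.*-homo a b)) e)

  regular-unit : ∀ {c b} → ¬ (σ b ≈ 0#) → Regular c b
  regular-unit {c} {b} σb≉0 = c , b , σb≉0 , ≈-refl

  RegularMultiple : Carrier → Fraction → Set
  RegularMultiple e f = Regular (e * numerator f) (denominator f)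

  regularMultiple-+ : ∀ e {f g} →
    RegularMultiple e f → RegularMultiple e g → RegularMultiple e (f +ᶠ g)
  regularMultiple-+ e {mkFraction a b _} {mkFraction c d _} (a′ , b′ , σb′ , p) (c′ , d′ , σd′ , q) =
    a′ * d′ + c′ * b′ , b′ * d′ , σ-*-≉0 σb′ σd′ , (begin
      e * (a * d + c * b) * (b′ * d′)
        ≈⟨ solve 7 (λ e a b c d b′ d′ → e :* (a :* d :+ c :* b) :* (b′ :* d′) :=
             (e :* a :* b′) :* (d :* d′) :+ (e :* c :* d′) :* (b :* b′)) ≈-refl e a b c d b′ d′ ⟩
      (e * a * b′) * (d * d′) + (e * c * d′) * (b * b′)
        ≈⟨ +-cong (*-congʳ p) (*-congʳ q) ⟩
      (a′ * b) * (d * d′) + (c′ * d) * (b * b′)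
        ≈⟨ solve 6 (λ a b c d b′ d′ → (a :* b) :* (d :* d′) :+ (c :* d) :* (b :* b′) :=
             (a :* d′ :+ c :* b′) :* (b :* d)) ≈-refl a′ b c′ d b′ d′ ⟩
      (a′ * d′ + c′ * b′) * (b * d) ∎)

  regularMultiple-≃ : ∀ e {f g} → f ≃ g → RegularMultiple e f → RegularMultiple e g
  regularMultiple-≃ e {mkFraction a b b≉0} {mkFraction c d _} f≃g (a′ , b′ , σb′ , p) =
    a′ , b′ , σb′ , *-cancelʳ b≉0 (begin
      e * c * b′ * b
        ≈⟨ solve 4 (λ e c b′ b → e :* c :* b′ :* b := e :* (c :* b) :* b′) ≈-refl e c b′ b ⟩
      e * (c * b) * b′   ≈⟨ *-congʳ (*-congˡ f≃g) ⟨
      e * (a * d) * b′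
        ≈⟨ solve 4 (λ e a d b′ → e :* (a :* d) :* b′ := e :* a :* b′ :* d) ≈-refl e a d b′ ⟩
      e * a * b′ * d     ≈⟨ *-congʳ p ⟩
      a′ * b * d         ≈⟨ solve 3 (λ a b d → a :* b :* d := a :* d :* b) ≈-refl a′ b d ⟩
      a′ * d * b         ∎)

  -- A ring homomorphism fixes 2, so σ does not kill it and 2 may be put into the denominator.
  regularMultiple-half : ¬ (1# + 1# ≈ 0#) →
    ∀ e {f} → RegularMultiple e (f +ᶠ f) → RegularMultiple e f
  regularMultiple-half 2≉0 e {mkFraction a b b≉0} (a′ , b′ , σb′ , p) =
    a′ , (1# + 1#) * b′ , σ-*-≉0 (λ σ2≈0 → 2≉0 (≈-trans (≈-sym σ2≈2) σ2≈0)) σb′ ,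
    *-cancelʳ b≉0 (begin
      e * a * ((1# + 1#) * b′) * b
        ≈⟨ solve 4 (λ e a b b′ → e :* a :* ((con 1 :+ con 1) :* b′) :* b :=
             e :* (a :* b :+ a :* b) :* b′) ≈-refl e a b b′ ⟩
      e * (a * b + a * b) * b′
        ≈⟨ p ⟩
      a′ * (b * b)
        ≈⟨ *-assoc a′ b b ⟨
      a′ * b * b ∎)
    where
    σ2≈2 : σ (1# + 1#) ≈ 1# + 1#
    σ2≈2 = ≈-trans (σ.+-homo 1# 1#) (+-cong σ.1#-homo σ.1#-homo)

  regularMultiple-0 : ∀ e → RegularMultiple e 0ᶠ
  regularMultiple-0 e = regular-unit λ σ1≈0 → 1≉0 (≈-trans (≈-sym σ.1#-homo) σ1≈0)

  regularMultiple-resp-≈ : ∀ {e e′} f → e ≈ e′ → RegularMultiple e f → RegularMultiple e′ f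
  regularMultiple-resp-≈ f e≈e′ (a , b , σb≉0 , p) =
    a , b , σb≉0 , ≈-trans (*-congʳ (*-congʳ (≈-sym e≈e′))) p

-- Cyclic lists

Unique-resp-↭ : ∀ {a} {A : Set a} {u v : List A} → u ↭ v → Unique u → Unique v
Unique-resp-↭ u↭v = SetoidPermutationₚ.Unique-resp-↭ (≡.setoid _) (↭⇒↭ₛ u↭v)

module _ {n : ℕ} where

  private variable
    i j : Fin n
    u v w : List (Fin n)

  ++-rotation : ∀ (u v : List (Fin n)) → u ++ v ≈ᵗ v ++ u
  ++-rotation []      v = subst (v ≈ᵗ_) (≡.sym (List.++-identityʳ v)) ε
  ++-rotation (i ∷ u) v = ≡.sym (List.++-assoc u v [ i ]) ◅
    subst (u ++ v ∷ʳ i ≈ᵗ_) (List.∷ʳ-++ v i u) (++-rotation u (v ∷ʳ i))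

  -- A chain of single rotations is reduced to one cut, a form that is visibly symmetric.
  ≈ᵗ⇒++ : u ≈ᵗ v → ∃[ p ] ∃[ q ] u ≡ p ++ q × v ≡ q ++ p
  ≈ᵗ⇒++ {u} ε = [] , u , refl , ≡.sym (List.++-identityʳ u)
  ≈ᵗ⇒++ {[]} (refl ◅ s) = ≈ᵗ⇒++ s
  ≈ᵗ⇒++ {i ∷ u} (refl ◅ s) with p , q , ui≡pq , v≡qp ← ≈ᵗ⇒++ s with initLast q
  -- With q empty the later rotations amount to none, so the cut is the one of the first rotation,
  -- just after i.
  ... | [] = [ i ] , u , refl ,
        ≡.trans v≡qp (≡.trans (≡.sym (List.++-identityʳ p)) (≡.sym ui≡pq))
  ... | q′ ∷ʳ′ k with refl , refl ← List.∷ʳ-injective u (p ++ q′)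
                       (≡.trans ui≡pq (≡.sym (List.++-assoc p q′ [ k ]))) =
        i ∷ p , q′ , refl , ≡.trans v≡qp (List.∷ʳ-++ q′ i p)

  ≈ᵗ-sym : u ≈ᵗ v → v ≈ᵗ u
  ≈ᵗ-sym s with p , q , refl , refl ← ≈ᵗ⇒++ s = ++-rotation q p

  ≈ᵗ-setoid : Setoid 0ℓ 0ℓ
  ≈ᵗ-setoid = record
    { Carrier = List (Fin n) ; _≈_ = _≈ᵗ_
    ; isEquivalence = record { refl = ε ; sym = ≈ᵗ-sym ; trans = _◅◅_ } }

  ≈ᵗ⇒↭ : u ≈ᵗ v → u ↭ v
  ≈ᵗ⇒↭ s with p , q , refl , refl ← ≈ᵗ⇒++ s = ++-comm p q

  map-≈ᵗ : ∀ (f : Fin n → Fin n) → u ≈ᵗ v → map f u ≈ᵗ map f v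
  map-≈ᵗ f = gmap (map f) λ { {u} refl → map-rotate u }
    where
    map-rotate : ∀ u → map f (rotate u) ≡ rotate (map f u)
    map-rotate []      = refl
    map-rotate (i ∷ u) = List.map-++ f u [ i ]

  -- A proper rotation would bring a second occurrence of i to the head.
  ≈ᵗ-head-injective : Unique (i ∷ u) → i ∷ u ≈ᵗ i ∷ v → u ≡ v
  ≈ᵗ-head-injective {i} {u} {v} iu! s with ≈ᵗ⇒++ s
  ... | []    , q     , refl , e = ≡.sym (List.∷-injectiveʳ (≡.trans e (List.++-identityʳ q)))
  ... | _ ∷ p , []    , refl , e = ≡.trans (List.++-identityʳ p) (≡.sym (List.∷-injectiveʳ e))
  ... | _ ∷ p , _ ∷ q , refl , refl =
        contradiction (∈-++⁺ʳ p (here refl)) (Unique[x∷xs]⇒x∉xs iu!)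

  total⇒∈ : IsTotalOrder w → ∀ i → i ∈ w
  total⇒∈ w↭ i = ∈-resp-↭ (↭-sym w↭) (∈-allFin i)

  total⇒unique : IsTotalOrder w → Unique w
  total⇒unique w↭ = Unique-resp-↭ (↭-sym w↭) (allFin⁺ n)

  total-resp-≈ᵗ : u ≈ᵗ v → IsTotalOrder u → IsTotalOrder v
  total-resp-≈ᵗ s u↭ = ↭-trans (↭-sym (≈ᵗ⇒↭ s)) u↭

  -- In the first two cases x_i - x_j divides the cyclic product up to sign; in `apart` the vertices
  -- a and b separate i from j on both sides.
  data CyclicPosition (i j : Fin n) (w : List (Fin n)) : Set where
    before : ∀ u → w ≈ᵗ i ∷ j ∷ u → CyclicPosition i j w
    after  : ∀ u → w ≈ᵗ j ∷ i ∷ u → CyclicPosition i j w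
    apart  : ∀ a u b v → w ≈ᵗ i ∷ (a ∷ u) ++ j ∷ (b ∷ v) → CyclicPosition i j w

  cyclicPosition : i ≢ j → i ∈ w → j ∈ w → CyclicPosition i j w
  cyclicPosition {i} {j} i≢j i∈w j∈w with ∈-∃++ i∈w
  ... | p , q , refl with ∈-resp-↭ (++-comm p (i ∷ q)) j∈w
  ...   | here j≡i = contradiction (≡.sym j≡i) i≢j
  ...   | there j∈ with s ← ++-rotation p (i ∷ q) with ∈-∃++ j∈
  ...     | []    , v     , e = before v (subst (λ z → p ++ i ∷ q ≈ᵗ i ∷ z) e s)
  ...     | a ∷ u , []    , e = after (a ∷ u)
            (subst (λ z → p ++ i ∷ q ≈ᵗ i ∷ z) e s ◅◅ ++-rotation (i ∷ a ∷ u) [ j ])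
  ...     | a ∷ u , b ∷ v , e = apart a u b v (subst (λ z → p ++ i ∷ q ≈ᵗ i ∷ z) e s)

module _ {a ℓ} {A : Set a} {R : A → A → Set ℓ} where

  AllPairs-∷ʳ : ∀ {ws z} → AllPairs R ws → All (λ y → R y z) ws → AllPairs R (ws ∷ʳ z)
  AllPairs-∷ʳ ps rs = AllPairs.++⁺ ps ([] ∷ []) (All.map (_∷ []) rs)

  AllPairs-map-All : ∀ {p ℓ′} {P : A → Set p} {S : A → A → Set ℓ′} {ws} →
    (∀ {y z} → P y → P z → R y z → S y z) → All P ws → AllPairs R ws → AllPairs S ws
  AllPairs-map-All f []        []        = []
  AllPairs-map-All f (py ∷ ps) (rs ∷ rss) =
    All.zipWith (λ (pz , r) → f py pz r) (ps , rs) ∷ AllPairs-map-All f ps rss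

  Linked-map-All : ∀ {p ℓ′} {P : A → Set p} {S : A → A → Set ℓ′} {ws} →
    (∀ {y z} → P y → P z → R y z → S y z) → All P ws → Linked R ws → Linked S ws
  Linked-map-All f []             []       = []
  Linked-map-All f (_ ∷ [])       [-]      = [-]
  Linked-map-All f (py ∷ pz ∷ ps) (r ∷ rs) = f py pz r ∷ Linked-map-All f (pz ∷ ps) rs

  Linked-∷ʳ : ∀ ws {y z} → Linked R (ws ∷ʳ y) → R y z → Linked R (ws ∷ʳ y ∷ʳ z)
  Linked-∷ʳ []           _        r = r ∷ [-]
  Linked-∷ʳ (_ ∷ [])     (s ∷ ss) r = s ∷ Linked-∷ʳ [] ss r
  Linked-∷ʳ (_ ∷ _ ∷ ws) (s ∷ ss) r = s ∷ Linked-∷ʳ (_ ∷ ws) ss r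

  Linked-∷ʳ⁻ : ∀ ws {y z} → Linked R (ws ∷ʳ y ∷ʳ z) → Linked R (ws ∷ʳ y) × R y z
  Linked-∷ʳ⁻ []           (r ∷ _)  = [-] , r
  Linked-∷ʳ⁻ (_ ∷ [])     (s ∷ ss) with rs , r ← Linked-∷ʳ⁻ [] ss = s ∷ rs , r
  Linked-∷ʳ⁻ (_ ∷ _ ∷ ws) (s ∷ ss) with rs , r ← Linked-∷ʳ⁻ (_ ∷ ws) ss = s ∷ rs , r

  Linked⇒predecessor : ∀ {y z ws} → Linked R (y ∷ ws) → z ∈ ws → ∃[ v ] v ∈ y ∷ ws × R v z
  Linked⇒predecessor (r ∷ rs) (here refl) = _ , here refl , r
  Linked⇒predecessor (_ ∷ rs) (there z∈)  with v , v∈ , r ← Linked⇒predecessor rs z∈ = v , there v∈ , r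

  Linked⇒successor : ∀ ws {y z} → Linked R (ws ∷ʳ z) → y ∈ ws → ∃[ v ] R y v
  Linked⇒successor (_ ∷ [])     (r ∷ _)  (here refl) = _ , r
  Linked⇒successor (_ ∷ _ ∷ ws) (r ∷ _)  (here refl) = _ , r
  Linked⇒successor (_ ∷ ws@(_ ∷ _)) (_ ∷ rs) (there y∈) = Linked⇒successor ws rs y∈

-- Toric total extensions

module _ {n : ℕ} where
  open Quiver
  open ≡-Reasoning

  module _ {k : Fin n} {Q Q′ : Quiver n} (f : FlipAt k Q Q′) where
    open FlipAt f

    flip-at : ∀ {i j} → i ≡ k ⊎ j ≡ k → arc Q′ i j ≡ arc Q j i
    flip-at {i} {j} i/j≡k with i ≟ k | j ≟ k | reversed i j
    ... | yes _   | _       | e = e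
    ... | no  _   | yes _   | e = e
    ... | no  i≢k | no  j≢k | e = contradiction i/j≡k [ i≢k , j≢k ]′

    flip-away : ∀ {i j} → i ≢ k → j ≢ k → arc Q′ i j ≡ arc Q i j
    flip-away {i} {j} i≢k j≢k with i ≟ k | j ≟ k | reversed i j
    ... | yes i≡k | _       | e = contradiction i≡k i≢k
    ... | no  _   | yes j≡k | e = contradiction j≡k j≢k
    ... | no  _   | no  _   | e = e

    flip-arc⁻ : ∀ {i j} → _⟶_ Q′ i j → _⟶_ Q i j ⊎ _⟶_ Q j i
    flip-arc⁻ {i} {j} a with i ≟ k | j ≟ k | reversed i j
    ... | yes _ | _     | e = inj₂ (subst T e a)
    ... | no  _ | yes _ | e = inj₂ (subst T e a)
    ... | no  _ | no  _ | e = inj₁ (subst T e a)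

  ∼-arc⁻ : ∀ {Q Q′ : Quiver n} {i j} → Q ∼ Q′ → _⟶_ Q′ i j → _⟶_ Q i j ⊎ _⟶_ Q j i
  ∼-arc⁻ ε                   a = inj₁ a
  ∼-arc⁻ ((k , f) ◅ Q∼Q′) a = [ flip-arc⁻ f , Sum.swap ∘ flip-arc⁻ f ]′ (∼-arc⁻ Q∼Q′ a)

  -- After the flip k is a sink, so no directed path leaves it; a cycle therefore avoids k and
  -- consists of old arcs.
  flipSource : ∀ (Q : Quiver n) k → IsSource Q k → Σ[ Q′ ∈ Quiver n ] FlipAt k Q Q′
  flipSource Q k source = record { arc = arc′ ; acyclic = acyclic′ } , record
    { sourceOrSink = inj₁ source ; reversed = λ _ _ → refl }
    where
    arc′ : Fin n → Fin n → Bool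
    arc′ i j = if ⌊ i ≟ k ⌋ ∨ ⌊ j ≟ k ⌋ then arc Q j i else arc Q i j

    sink : ∀ j → ¬ arc′ ⊢ k ⟶ j
    sink j a with k ≟ k
    ... | yes _   = source j a
    ... | no  k≢k = contradiction refl k≢k

    old : ∀ {i j} → i ≢ k → j ≢ k → arc′ ⊢ i ⟶ j → _⟶_ Q i j
    old {i} {j} i≢k j≢k a with i ≟ k | j ≟ k
    ... | yes i≡k | _       = contradiction i≡k i≢k
    ... | no  _   | yes j≡k = contradiction j≡k j≢k
    ... | no  _   | no  _   = a

    start≢k : ∀ {i j} → TransClosure (arc′ ⊢_⟶_) i j → i ≢ k
    start≢k [ a ]⁺     refl = sink _ a
    start≢k (a ∷⁺ _) refl = sink _ a

    oldPath : ∀ {i j} → j ≢ k → TransClosure (arc′ ⊢_⟶_) i j → TransClosure (_⟶_ Q) i j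
    oldPath j≢k p@([ a ]⁺)     = [ old (start≢k p) j≢k a ]⁺
    oldPath j≢k p@(a ∷⁺ p′) = old (start≢k p) (start≢k p′) a ∷⁺ oldPath j≢k p′

    acyclic′ : ∀ i → ¬ TransClosure (arc′ ⊢_⟶_) i i
    acyclic′ i p = acyclic Q i (oldPath (start≢k p) p)

  noLoop : ∀ (Q : Quiver n) {i} → ¬ _⟶_ Q i i
  noLoop Q a = acyclic Q _ [ a ]⁺

  -- For a total order this says that it is a linear extension of the quiver. All pairs are tested,
  -- so no transitive closure is needed.
  Compatible : Quiver n → List (Fin n) → Set
  Compatible Q = AllPairs λ i j → ¬ _⟶_ Q j i

  -- The combinatorial form of `IsToricTotalExtension`, free of points of the torus;
  -- `toricTotalExtension⇒` and `toricTotalExtension⇐` show that they agree.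
  TotalExtension : Quiver n → List (Fin n) → Set
  TotalExtension Q w = IsTotalOrder w × Σ[ Q′ ∈ Quiver n ] Q ∼ Q′ × Compatible Q′ w

  compatible⇒source : ∀ (Q′ : Quiver n) {i u} → IsTotalOrder (i ∷ u) → Compatible Q′ (i ∷ u) →
    IsSource Q′ i
  compatible⇒source Q′ iu↭ (c ∷ _) j with total⇒∈ iu↭ j
  ... | here refl = noLoop Q′
  ... | there j∈u = All.lookup c j∈u

  compatible⇒arc-to-second : ∀ (Q′ : Quiver n) {i j u} → IsTotalOrder (i ∷ j ∷ u) →
    Compatible Q′ (i ∷ j ∷ u) → ∀ v → _⟶_ Q′ v j → v ≡ i
  compatible⇒arc-to-second Q′ w↭ (_ ∷ c ∷ _) v a with total⇒∈ w↭ v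
  ... | here v≡i           = v≡i
  ... | there (here refl)  = contradiction a (noLoop Q′)
  ... | there (there v∈)   = contradiction a (All.lookup c v∈)

  module _ {Q : Quiver n} where

    -- The first vertex is a source of the witnessing member. Flipping it yields a sink, which may
    -- stand last.
    totalExtension-rotate : ∀ {w} → TotalExtension Q w → TotalExtension Q (rotate w)
    totalExtension-rotate {[]}    ext = ext
    totalExtension-rotate {i ∷ u} (iu↭ , Q′ , Q∼Q′ , c ∷ cs)
      with Q″ , f ← flipSource Q′ i (compatible⇒source Q′ iu↭ (c ∷ cs)) =
      total-resp-≈ᵗ (refl ◅ ε) iu↭ , Q″ , Q∼Q′ ◅◅ ((i , f) ◅ ε) ,
      AllPairs-∷ʳ
        (AllPairs-map-All (λ i≢j i≢k ¬a a → ¬a (subst T (flip-away f (i≢k ∘ ≡.sym) (i≢j ∘ ≡.sym)) a))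
          (AllPairs.head (total⇒unique iu↭)) cs)
        (All.map (λ ¬a a → ¬a (subst T (flip-at f (inj₁ refl)) a)) c)

    totalExtension-resp-≈ᵗ : ∀ {u v} → u ≈ᵗ v → TotalExtension Q u → TotalExtension Q v
    totalExtension-resp-≈ᵗ ε          ext = ext
    totalExtension-resp-≈ᵗ (refl ◅ s) ext = totalExtension-resp-≈ᵗ s (totalExtension-rotate ext)

    -- Flips preserve the underlying graph, so the witnessing member has no arc between i and j
    -- either and serves for both orders.
    totalExtension-swap : ∀ {i j u} → ¬ _⟶_ Q i j → ¬ _⟶_ Q j i →
      TotalExtension Q (i ∷ j ∷ u) → TotalExtension Q (j ∷ i ∷ u)
    totalExtension-swap {i} {j} ¬ij ¬ji (w↭ , Q′ , Q∼Q′ , (_ ∷ ci) ∷ cj ∷ cs) =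
      ↭-trans (↭-swap j i _↭_.refl) w↭ , Q′ , Q∼Q′ ,
      ([ ¬ij , ¬ji ]′ ∘ ∼-arc⁻ Q∼Q′ ∷ cj) ∷ ci ∷ cs

  -- Toric paths under flips, and arcs outside the Hasse diagram

  HasToricRotation : Quiver n → List (Fin n) → Set
  HasToricRotation Q ws = ∃[ i ] ∃[ j ] ∃[ ws′ ] ws ≈ᵗ ws′ × ToricPath Q i j ws′

  -- Every vertex but the first has a predecessor on the path, so a source can only be the first;
  -- dually a sink can only be the last. If k is not such an end, the path survives unchanged.
  flip-toricPath : ∀ {k} {Q Q′ : Quiver n} → FlipAt k Q Q′ → ∀ {i j ws} → ToricPath Q i j ws →
    HasToricRotation Q′ ws
  flip-toricPath f (vertex i) = i , i , [ i ] , ε , vertex i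
  flip-toricPath {k} {Q} {Q′} f (path {i} {j} vs ws! ws⟶ i⟶j) with FlipAt.sourceOrSink f
  ... | inj₁ source = atSource (k ≟ i)
    where
    others≢k : ∀ {i ws} → Linked (_⟶_ Q) (i ∷ ws) → All (_≢ k) ws
    others≢k r = All.tabulate λ { z∈ refl → let v , _ , a = Linked⇒predecessor r z∈ in source v a }
    away : ∀ {ws} → All (_≢ k) ws → Linked (_⟶_ Q) ws → Linked (_⟶_ Q′) ws
    away = Linked-map-All λ y≢k z≢k → subst T (≡.sym (flip-away f y≢k z≢k))
    atSource : Dec (k ≡ i) → HasToricRotation Q′ (i ∷ vs ∷ʳ j)
    atSource (no k≢i) = i , j , i ∷ vs ∷ʳ j , ε ,
      path vs ws! (away (k≢i ∘ ≡.sym ∷ others≢k ws⟶) ws⟶)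
        (subst T (≡.sym (flip-away f (k≢i ∘ ≡.sym) λ { refl → source i i⟶j })) i⟶j)
    -- The arc spanning the path and its first arc trade places: reversed, the former becomes the
    -- last arc of the rotated path and the latter spans it.
    atSource (yes refl) = rotated vs ws! ws⟶
      where
      at : ∀ {z} → _⟶_ Q i z → _⟶_ Q′ z i
      at = subst T (≡.sym (flip-at f (inj₂ refl)))
      rotated : ∀ vs → Unique (i ∷ vs ∷ʳ j) → Linked (_⟶_ Q) (i ∷ vs ∷ʳ j) →
        HasToricRotation Q′ (i ∷ vs ∷ʳ j)
      rotated [] ws! _ = j , i , j ∷ [] ∷ʳ i , refl ◅ ε ,
        path [] (Unique-resp-↭ (≈ᵗ⇒↭ (++-rotation [ i ] [ j ])) ws!) (at i⟶j ∷ [-]) (at i⟶j)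
      rotated (v ∷ vs) ws! (i⟶v ∷ r) = v , i , v ∷ (vs ∷ʳ j) ∷ʳ i , refl ◅ ε ,
        path (vs ∷ʳ j) (Unique-resp-↭ (≈ᵗ⇒↭ (refl ◅ ε)) ws!)
          (Linked-∷ʳ (v ∷ vs) (away (others≢k (i⟶v ∷ r)) r) (at i⟶j)) (at i⟶v)
  ... | inj₂ sink = atSink (k ≟ j)
    where
    others≢k : ∀ ws {z} → Linked (_⟶_ Q) (ws ∷ʳ z) → All (_≢ k) ws
    others≢k ws r = All.tabulate λ { y∈ refl → let v , a = Linked⇒successor ws r y∈ in sink v a }
    away : ∀ {ws} → All (_≢ k) ws → Linked (_⟶_ Q) ws → Linked (_⟶_ Q′) ws
    away = Linked-map-All λ y≢k z≢k → subst T (≡.sym (flip-away f y≢k z≢k))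
    atSink : Dec (k ≡ j) → HasToricRotation Q′ (i ∷ vs ∷ʳ j)
    atSink (no k≢j) = i , j , i ∷ vs ∷ʳ j , ε ,
      path vs ws! (away (All.∷ʳ⁺ (others≢k (i ∷ vs) ws⟶) (k≢j ∘ ≡.sym)) ws⟶)
        (subst T (≡.sym (flip-away f (λ { refl → sink j i⟶j }) (k≢j ∘ ≡.sym))) i⟶j)
    atSink (yes refl) with initLast vs
    ... | [] = j , i , j ∷ [] ∷ʳ i , refl ◅ ε ,
      path [] (Unique-resp-↭ (≈ᵗ⇒↭ (++-rotation [ i ] [ j ])) ws!) (at i⟶j ∷ [-]) (at i⟶j)
      where
      at : ∀ {z} → _⟶_ Q z j → _⟶_ Q′ j z
      at = subst T (≡.sym (flip-at f (inj₁ refl)))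
    ... | ms ∷ʳ′ l with r , l⟶j ← Linked-∷ʳ⁻ (i ∷ ms) ws⟶ =
      j , l , j ∷ (i ∷ ms) ∷ʳ l , ++-rotation (i ∷ ms ∷ʳ l) [ j ] ,
      path (i ∷ ms) (Unique-resp-↭ (≈ᵗ⇒↭ (++-rotation (i ∷ ms ∷ʳ l) [ j ])) ws!)
        (at i⟶j ∷ away (others≢k (i ∷ ms ∷ʳ l) ws⟶) r) (at l⟶j)
      where
      at : ∀ {z} → _⟶_ Q z j → _⟶_ Q′ j z
      at = subst T (≡.sym (flip-at f (inj₁ refl)))

  ∼-toricPath : ∀ {Q Q′ : Quiver n} → Q ∼ Q′ → ∀ {i j ws} → ToricPath Q i j ws →
    HasToricRotation Q′ ws
  ∼-toricPath ε             p = _ , _ , _ , ε , p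
  ∼-toricPath ((_ , f) ◅ s) p
    with _ , _ , _ , ws≈ws′ , p′ ← flip-toricPath f p
    with _ , _ , _ , ws′≈ws″ , p″ ← ∼-toricPath s p′ = _ , _ , _ , ws≈ws′ ◅◅ ws′≈ws″ , p″

  toricPath⇒linked : ∀ {Q : Quiver n} {i j ws} → ToricPath Q i j ws → Linked (_⟶_ Q) ws
  toricPath⇒linked (vertex _)     = [-]
  toricPath⇒linked (path _ _ r _) = r

  toricPath⇒unique : ∀ {Q : Quiver n} {i j ws} → ToricPath Q i j ws → Unique ws
  toricPath⇒unique (vertex _)     = [] ∷ []
  toricPath⇒unique (path _ u _ _) = u

  -- Having no predecessor, i must come first. Were j later than second, its predecessor would be a
  -- second occurrence of i.
  linked-start : ∀ {R : Fin n → Fin n → Set} {i j ws} → i ≢ j →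
    (∀ v → ¬ R v i) → (∀ v → R v j → v ≡ i) →
    Unique ws → Linked R ws → i ∈ ws → j ∈ ws → ∃[ rest ] ws ≡ i ∷ j ∷ rest
  linked-start i≢j minimal unique ws! r (there i∈) j∈ =
    let v , _ , a = Linked⇒predecessor r i∈ in contradiction a (minimal v)
  linked-start i≢j minimal unique ws! r (here refl) (here j≡i) = contradiction (≡.sym j≡i) i≢j
  linked-start i≢j minimal unique ws! r (here refl) (there (here refl)) = _ , refl
  linked-start i≢j minimal unique ws! (_ ∷ r) (here refl) (there (there j∈))
    with v , v∈ , a ← Linked⇒predecessor r j∈ with refl ← unique v a =
    contradiction v∈ (Unique[x∷xs]⇒x∉xs ws!)

  Unique-∷ʳ-++⇒∉ : ∀ us {i : Fin n} {vs} → Unique (us ∷ʳ i ++ vs) → i ∉ vs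
  Unique-∷ʳ-++⇒∉ []       ws!       = Unique[x∷xs]⇒x∉xs ws!
  Unique-∷ʳ-++⇒∉ (_ ∷ us) (_ ∷ ws!) = Unique-∷ʳ-++⇒∉ us ws!

  -- The path is carried to the member with this order as a linear extension. There i is a source
  -- and no other vertex has an arc into j, so the carried path begins with i and j.
  toricPath-adjacent : ∀ {Q : Quiver n} {i j u a b ws} → TotalExtension Q (i ∷ j ∷ u) →
    ToricPath Q a b ws → i ∈ ws → j ∈ ws → ∃[ rest ] ws ≈ᵗ i ∷ j ∷ rest
  toricPath-adjacent {i = i} {j} {u} (w↭ , Q′ , Q∼Q′ , c) p i∈ j∈
    with _ , _ , ws′ , ws≈ws′ , p′ ← ∼-toricPath Q∼Q′ p
    with rest , refl ← linked-start (All.head (AllPairs.head (total⇒unique w↭)))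
      (compatible⇒source Q′ w↭ c) (compatible⇒arc-to-second Q′ w↭ c)
      (toricPath⇒unique p′) (toricPath⇒linked p′)
      (∈-resp-↭ (≈ᵗ⇒↭ ws≈ws′) i∈) (∈-resp-↭ (≈ᵗ⇒↭ ws≈ws′) j∈) = rest , ws≈ws′

  -- Not being a Hasse arc is a doubly negated existence, so no offending path can be extracted.
  -- Instead, an extension with i and j adjacent forces every toric path from i to j of length above
  -- one to be maximal, which would make the arc a Hasse arc.
  longArc-nonadjacent : ∀ {Q : Quiver n} {i j} → _⟶_ Q i j → ¬ HasseArc Q i j → ∀ {u} →
    ¬ TotalExtension Q (i ∷ j ∷ u) × ¬ TotalExtension Q (j ∷ i ∷ u)
  longArc-nonadjacent {Q} {i} {j} i⟶j ¬hasse {u} =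
    (λ ext → ¬hasse (i⟶j , λ (vs , p , ¬max , long) → ¬max
      (maximal p long λ q i∈ j∈ → inj₁ (toricPath-adjacent ext q i∈ j∈)))) ,
    (λ ext → ¬hasse (i⟶j , λ (vs , p , ¬max , long) → ¬max
      (maximal p long λ q i∈ j∈ → inj₂ (toricPath-adjacent ext q j∈ i∈))))
    where
    maximal : ∀ {vs} → ToricPath Q i j vs → 1 < pathLength Q vs →
      (∀ {a b ws} → ToricPath Q a b ws → i ∈ ws → j ∈ ws →
        (∃[ rest ] ws ≈ᵗ i ∷ j ∷ rest) ⊎ (∃[ rest ] ws ≈ᵗ j ∷ i ∷ rest)) →
      IsMaximal Q vs
    maximal (path []       _ _ _) (s≤s ()) _
    maximal (path (m ∷ ms) _ _ _) _ adjacent {ws = ws} q inf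
      with Infix.toView inf
    ... | Infix.MkView pref {inf′} eq suff with refl ← Pointwise-≡⇒≡ eq =
      outside (initLast (suff ++ pref)) refl
      where
      vs = i ∷ (m ∷ ms) ∷ʳ j
      -- Rotating gathers everything outside `vs` into a single block that leads from j back to i.
      ws≈ : pref ++ vs ++ suff ≈ᵗ vs ++ suff ++ pref
      ws≈ = subst (pref ++ vs ++ suff ≈ᵗ_) (List.++-assoc vs suff pref) (++-rotation pref (vs ++ suff))
      ws! : Unique (vs ++ suff ++ pref)
      ws! = Unique-resp-↭ (≈ᵗ⇒↭ ws≈) (toricPath⇒unique q)
      i∈ : i ∈ pref ++ vs ++ suff
      i∈ = ∈-++⁺ʳ pref (here refl)
      j∈ : j ∈ pref ++ vs ++ suff
      j∈ = ∈-++⁺ʳ pref (∈-++⁺ˡ {xs = vs} (∈-++⁺ʳ (i ∷ m ∷ ms) (here refl)))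
      outside : ∀ {γ} → InitLast γ → suff ++ pref ≡ γ → vs ≡ pref ++ vs ++ suff
      outside [] e with refl ← List.++-conicalˡ suff pref e | refl ← List.++-conicalʳ suff pref e =
        ≡.sym (List.++-identityʳ vs)
      outside (γ ∷ʳ′ g) e with adjacent q i∈ j∈
      -- The vertex after i is m, so m = j, yet j occurs again at the end of `vs`.
      ... | inj₁ (rest , s)
          with refl ← ≈ᵗ-head-injective ws! (≈ᵗ-sym ws≈ ◅◅ s) =
          contradiction (∈-++⁺ˡ (∈-++⁺ʳ ms (here refl)))
            (Unique[x∷xs]⇒x∉xs (AllPairs.tail ws!))
      -- Read from i, the cycle ends with the outside vertex g, so g = j, yet j lies in `vs`.
      ... | inj₂ (rest , s)
          with refl ← List.∷ʳ-injectiveʳ ((m ∷ ms) ∷ʳ j ++ γ) rest (begin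
            ((m ∷ ms) ∷ʳ j ++ γ) ∷ʳ g     ≡⟨ List.++-assoc ((m ∷ ms) ∷ʳ j) γ [ g ] ⟩
            (m ∷ ms) ∷ʳ j ++ γ ∷ʳ g       ≡⟨ cong ((m ∷ ms) ∷ʳ j ++_) e ⟨
            (m ∷ ms) ∷ʳ j ++ suff ++ pref ≡⟨ ≈ᵗ-head-injective ws! (≈ᵗ-sym ws≈ ◅◅ s ◅◅ (refl ◅ ε)) ⟩
            rest ∷ʳ j                     ∎) =
          contradiction (subst (g ∈_) (≡.sym e) (∈-++⁺ʳ γ (here refl)))
            (Unique-∷ʳ-++⇒∉ (i ∷ m ∷ ms) ws!)

-- Chambers of toric total orders: from points to linear extensions

fromℚ : ∀ r → 0ℚ ≤ℚ r → r <ℚ 1ℚ → ℝ/ℤ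
fromℚ r 0≤r r<1 = record
  { value = record
    { Lower = _<ℚ r
    ; Upper = r <ℚ_
    ; lower-inhabited = -ℚ 1ℚ , ℚ.<-≤-trans (ℚ.negative⁻¹ (-ℚ 1ℚ)) 0≤r
    ; upper-inhabited = 1ℚ , r<1
    ; lower-rounded = λ p → mk⇔ ℚ.<-dense λ (q , p<q , q<r) → ℚ.<-trans p<q q<r
    ; upper-rounded = λ q → mk⇔
        (λ r<q → let p , r<p , p<q = ℚ.<-dense r<q in p , p<q , r<p)
        (λ (p , p<q , r<p) → ℚ.<-trans r<p p<q)
    ; disjoint = λ q (q<r , r<q) → ℚ.<-asym q<r r<q
    ; located = located }
  ; 0≤value = λ r<0 → ℚ.<-irrefl refl (ℚ.≤-<-trans 0≤r r<0)
  ; value<1 = r<1 }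
  where
  located : ∀ {p q} → p <ℚ q → p <ℚ r ⊎ r <ℚ q
  located {p} p<q with p ℚ.<? r
  ... | yes p<r = inj₁ p<r
  ... | no  p≮r = inj₂ (ℚ.≤-<-trans (ℚ.≮⇒≥ p≮r) p<q)

<ᴿ-trans : ∀ {a b c} → a <ᴿ b → b <ᴿ c → a <ᴿ c
<ᴿ-trans {a} {b} {c} (q , a<q , q<b) (r , b<r , r<c) with ℚ.<-cmp q r
... | tri< q<r _ _    = q , a<q , Equivalence.from (ℝ.lower-rounded c q) (r , q<r , r<c)
... | tri≈ _ refl _   = q , a<q , r<c
... | tri> _ _ r<q    = contradiction
  (Equivalence.from (ℝ.lower-rounded b r) (q , r<q , q<b) , b<r) (ℝ.disjoint b r)

-- Any strictly increasing sequence of rationals in [0,1) would serve; density supplies a next term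
-- below 1.
level : ℕ → Σ[ r ∈ ℚ ] 0ℚ ≤ℚ r × r <ℚ 1ℚ
level zero    = 0ℚ , ℚ.≤-refl , ℚ.positive⁻¹ 1ℚ
level (suc k) = let r , 0≤r , r<1 = level k ; s , r<s , s<1 = ℚ.<-dense r<1 in
  s , ℚ.≤-trans 0≤r (ℚ.<⇒≤ r<s) , s<1

level-step : ∀ k → proj₁ (level k) <ℚ proj₁ (level (suc k))
level-step k = proj₁ (proj₂ (ℚ.<-dense (proj₂ (proj₂ (level k)))))

level-mono : ∀ {k l} → k ℕ.< l → proj₁ (level k) <ℚ proj₁ (level l)
level-mono {k} {suc l} k<1+l with ℕ.m≤n⇒m<n∨m≡n (ℕ.s≤s⁻¹ k<1+l)
... | inj₁ k<l  = ℚ.<-trans (level-mono k<l) (level-step l)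
... | inj₂ refl = level-step l

module _ {n : ℕ} where
  open Quiver using (_⟶_)

  heights : ∀ {w : List (Fin n)} → Unique w → Σ[ h ∈ (Fin n → ℕ) ] AllPairs (λ i j → h i ℕ.< h j) w
  heights []                      = (λ _ → 0) , []
  heights {i ∷ w} (i∉w ∷ w!) =
    h′ , All.map (λ {j} i≢j → subst₂ ℕ._<_ (≡.sym h′i) (≡.sym (h′j (i≢j ∘ ≡.sym))) z<s) i∉w ∷
      AllPairs-map-All
        (λ i≢j i≢k → subst₂ ℕ._<_ (≡.sym (h′j (i≢j ∘ ≡.sym))) (≡.sym (h′j (i≢k ∘ ≡.sym))) ∘ s<s)
        i∉w (proj₂ (heights w!))
    where
    h′ : Fin n → ℕ
    h′ j with j ≟ i
    ... | yes _ = 0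
    ... | no  _ = suc (proj₁ (heights w!) j)
    h′i : h′ i ≡ 0
    h′i with i ≟ i
    ... | yes _   = refl
    ... | no  i≢i = contradiction refl i≢i
    h′j : ∀ {j} → j ≢ i → h′ j ≡ suc (proj₁ (heights w!) j)
    h′j {j} j≢i with j ≟ i
    ... | yes j≡i = contradiction j≡i j≢i
    ... | no  _   = refl

  -- One test point is enough: its coordinates increase along w, so the member of [Q] that it
  -- orients has no arc running backwards in w.
  toricTotalExtension⇒ : ∀ {Q : Quiver n} {w} → IsToricTotalExtension Q w → TotalExtension Q w
  toricTotalExtension⇒ {Q} {w} (w↭ , inChamber)
    with h , h↑ ← heights (total⇒unique w↭)
    with Q′ , Q∼Q′ , ⟶⇒≺ ← inChamber
      (λ i → let r , 0≤r , r<1 = level (h i) in fromℚ r 0≤r r<1)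
      (w , ε , AllPairs⇒Linked (AllPairs.map
        (λ hi<hj → let q , i<q , q<j = ℚ.<-dense (level-mono hi<hj) in q , i<q , q<j) h↑)) =
    w↭ , Q′ , Q∼Q′ , AllPairs.map (λ hi<hj j⟶i → let q , j<q , q<i = ⟶⇒≺ j⟶i in
      ℚ.<-asym (level-mono hi<hj) (ℚ.<-trans j<q q<i)) h↑

  AllPairs-∈ : ∀ {R : Fin n → Fin n → Set} {w i j} → AllPairs R w →
    i ∈ w → j ∈ w → i ≢ j → R i j ⊎ R j i
  AllPairs-∈ (r ∷ rs) (here refl) (here refl) i≢j = contradiction refl i≢j
  AllPairs-∈ (r ∷ rs) (here refl) (there j∈)  i≢j = inj₁ (All.lookup r j∈)
  AllPairs-∈ (r ∷ rs) (there i∈)  (here refl) i≢j = inj₂ (All.lookup r i∈)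
  AllPairs-∈ (r ∷ rs) (there i∈)  (there j∈)  i≢j = AllPairs-∈ rs i∈ j∈ i≢j

  -- A point in the chamber of w sorts the vertices into some rotation `w′`; the member obtained by
  -- rotating the witness to `w′` orients every arc as the coordinates do.
  toricTotalExtension⇐ : ∀ {Q : Quiver n} {w} → TotalExtension Q w → IsToricTotalExtension Q w
  toricTotalExtension⇐ {Q} {w} ext@(w↭ , _) = w↭ , λ p (w′ , w≈w′ , linked) →
    let w′↭ , Q′ , Q∼Q′ , compatible = totalExtension-resp-≈ᵗ w≈w′ ext
        ordered = Linked⇒AllPairs
          (λ {i} {j} {k} → <ᴿ-trans {ℝ/ℤ.value (p i)} {ℝ/ℤ.value (p j)} {ℝ/ℤ.value (p k)}) linked
    in Q′ , Q∼Q′ , λ {i} {j} i⟶j → arc⇒≺ Q′ p w′ (total⇒∈ w′↭) compatible ordered i⟶j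
    where
    arc⇒≺ : ∀ (Q′ : Quiver n) (p : Point) w′ → (∀ i → i ∈ w′) → Compatible Q′ w′ →
      AllPairs (p ⊨_≺_) w′ → ∀ {i j} → _⟶_ Q′ i j → p ⊨ i ≺ j
    arc⇒≺ Q′ p w′ all∈ compatible ordered {i} {j} i⟶j
      with AllPairs-∈ (AllPairs.zip (compatible , ordered)) (all∈ i) (all∈ j)
             (λ { refl → noLoop Q′ i⟶j })
    ... | inj₁ (_ , i≺j)   = i≺j
    ... | inj₂ (¬i⟶j , _) = contradiction i⟶j ¬i⟶j

-- Poles

AllPairs-++⁻ : ∀ {a ℓ} {A : Set a} {R : A → A → Set ℓ} us {vs} →
  AllPairs R (us ++ vs) → AllPairs R us × AllPairs R vs
AllPairs-++⁻ []       rs       = [] , rs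
AllPairs-++⁻ (_ ∷ us) (r ∷ rs) with rus , rvs ← AllPairs-++⁻ us rs = All.++⁻ˡ us r ∷ rus , rvs

module _ {n : ℕ} (i j : Fin n) where

  transpose-fst : transpose i j i ≡ j
  transpose-fst with i ≟ i
  ... | yes _   = refl
  ... | no  i≢i = contradiction refl i≢i

  transpose-snd : transpose i j j ≡ i
  transpose-snd with j ≟ i
  ... | yes j≡i = j≡i
  ... | no  _ with j ≟ j
  ...   | yes _   = refl
  ...   | no  j≢j = contradiction refl j≢j

  transpose-other : ∀ {k} → k ≢ i → k ≢ j → transpose i j k ≡ k
  transpose-other {k} k≢i k≢j with k ≟ i
  ... | yes k≡i = contradiction k≡i k≢i
  ... | no  _ with k ≟ j
  ...   | yes k≡j = contradiction k≡j k≢j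
  ...   | no  _   = refl

  transpose-involutive : ∀ k → transpose i j (transpose i j k) ≡ k
  transpose-involutive k with k ≟ i
  ... | yes refl = transpose-snd
  ... | no  k≢i with k ≟ j
  ...   | yes refl = transpose-fst
  ...   | no  k≢j  = transpose-other k≢i k≢j

module _ (n : ℕ) where

  open IntegralDomain ℚ[x n ] hiding (zero)
    renaming (refl to ≈-refl; sym to ≈-sym; trans to ≈-trans)
  open RationalFunctions n
  open Fractions ℚ[x n ]
  open AbelianGroupProperties +-abelianGroup
    using (⁻¹-anti-homo‿-; ⁻¹-involutive; ε⁻¹≈ε; x∙y⁻¹≈ε⇒x≈y)
  open RingProperties ring using (-‿distribˡ-*; -‿distribʳ-*)
  open SetoidReasoning setoid
  open NaturalCoefficients commutativeSemiring using (solve; _:+_; _:*_; _:=_; con)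
  private
    module +ᶠ = CommutativeMonoid +ᶠ-commutativeMonoid
    module +ᶠₚ = CommutativeSemigroupProperties +ᶠ.commutativeSemigroup

  open SetoidPermutation (≈ᵗ-setoid {n}) using () renaming (_↭_ to _↭ᵗ_)

  cyclicProduct : List (Fin n) → Polynomial n
  cyclicProduct w = ∏ (zipWith difference w (rotate w))

  -- The product of the differences along the steps from a through w to z. Unlike the zip with a
  -- rotation, it can be split at any vertex.
  walk : Fin n → List (Fin n) → Fin n → Polynomial n
  walk a []      z = difference a z
  walk a (b ∷ w) z = difference a b * walk b w z

  ∏-zipWith≈walk : ∀ a w z → ∏ (zipWith difference (a ∷ w) (w ∷ʳ z)) ≈ walk a w z
  ∏-zipWith≈walk a []      z = *-identityʳ _
  ∏-zipWith≈walk a (b ∷ w) z = *-congˡ (∏-zipWith≈walk b w z)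

  walk-++ : ∀ a u b v z → walk a (u ++ b ∷ v) z ≈ walk a u b * walk b v z
  walk-++ a []      b v z = ≈-refl
  walk-++ a (c ∷ u) b v z = ≈-trans (*-congˡ (walk-++ c u b v z)) (≈-sym (*-assoc _ _ _))

  -- Used with two multiplicative properties: not being killed by σ, and `Admissible`.
  walk-closed : ∀ {ℓ ℓ′} {R : Fin n → Fin n → Set ℓ} {P : Polynomial n → Set ℓ′} →
    (∀ {p q} → P p → P q → P (p * q)) → (∀ {a b} → R a b → P (difference a b)) →
    ∀ {a w z} → Linked R (a ∷ w ∷ʳ z) → P (walk a w z)
  walk-closed *-closed base {w = []}    (r ∷ _)  = base r
  walk-closed {R = R} {P} *-closed base {w = b ∷ w} (r ∷ rs) =
    *-closed (base r) (walk-closed {R = R} {P} *-closed base {w = w} rs)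

  cyclicProduct-rotate : ∀ w → cyclicProduct w ≈ cyclicProduct (rotate w)
  cyclicProduct-rotate []          = ≈-refl
  cyclicProduct-rotate (a ∷ [])    = ≈-refl
  cyclicProduct-rotate (a ∷ b ∷ w) = begin
    cyclicProduct (a ∷ b ∷ w)        ≈⟨ ∏-zipWith≈walk a (b ∷ w) a ⟩
    difference a b * walk b w a      ≈⟨ *-comm _ _ ⟩
    walk b w a * difference a b      ≈⟨ walk-++ b w a [] b ⟨
    walk b (w ∷ʳ a) b                ≈⟨ ∏-zipWith≈walk b (w ∷ʳ a) b ⟨
    cyclicProduct (b ∷ w ∷ʳ a)       ∎

  cyclicProduct-≈ᵗ : ∀ {u v} → u ≈ᵗ v → cyclicProduct u ≈ cyclicProduct v
  cyclicProduct-≈ᵗ ε              = ≈-refl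
  cyclicProduct-≈ᵗ {u} (refl ◅ s) = ≈-trans (cyclicProduct-rotate u) (cyclicProduct-≈ᵗ s)

  difference≉0 : ∀ {i j} → i ≢ j → ¬ (difference i j ≈ 0#)
  difference≉0 i≢j e = i≢j (x-injective (x∙y⁻¹≈ε⇒x≈y _ _ e))

  -difference : ∀ i j → - difference i j ≈ difference j i
  -difference i j = ⁻¹-anti-homo‿- (x i) (x j)

  ∏-∈ : ∀ {p ps} → p ∈ ps → ∃[ e ] ∏ ps ≈ p * e
  ∏-∈ {ps = _ ∷ ps} (here refl) = ∏ ps , ≈-refl
  ∏-∈ {p} {q ∷ ps} (there p∈)  with e , ∏≈ ← ∏-∈ p∈ = q * e , (begin
    q * ∏ ps    ≈⟨ *-congˡ ∏≈ ⟩
    q * (p * e) ≈⟨ solve 3 (λ q p e → q :* (p :* e) := p :* (q :* e)) ≈-refl q p e ⟩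
    p * (q * e) ∎)

  ∏≉0 : ∀ {ps} → All (λ p → ¬ (p ≈ 0#)) ps → ¬ (∏ ps ≈ 0#)
  ∏≉0 []       = 1≉0
  ∏≉0 (p ∷ ps) = *-≉0 p (∏≉0 ps)

  -- From regularity along all hyperplanes to divisibility

  Regular : Fin n → Fin n → Polynomial n → Polynomial n → Set
  Regular i j = Regularity.Regular ℚ[x n ] (Merge.σ-isRingHom i j)

  -- A local-to-global principle for the denominator b. The numerator is left arbitrary so that the
  -- principle can be iterated over the factors of b.
  Cancellable : Polynomial n → Set
  Cancellable b = ∀ c → (∀ {i j} → i ≢ j → Regular i j c b) → ∃[ e ] c ≈ e * b

  cancellable-resp-≈ : ∀ {b b′} → b ≈ b′ → Cancellable b → Cancellable b′
  cancellable-resp-≈ b≈b′ cancel c regular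
    with e , c≈ ← cancel c (λ i≢j → let a , b , σb , p = regular i≢j in
      a , b , σb , ≈-trans p (*-congˡ (≈-sym b≈b′))) = e , ≈-trans c≈ (*-congˡ b≈b′)

  cancellable-1 : Cancellable 1#
  cancellable-1 c _ = c , ≈-sym (*-identityʳ c)

  -- Regularity of c/(b b′) implies that of c/b, so c = e b; the same hypothesis then says that e/b′
  -- is regular.
  cancellable-* : ∀ {b b′} → ¬ (b ≈ 0#) → Cancellable b → Cancellable b′ → Cancellable (b * b′)
  cancellable-* {b} {b′} b≉0 cancel cancel′ c regular
    with e , c≈ ← cancel c (λ i≢j → let a , d , σd , p = regular i≢j in a * b′ , d , σd , (begin
      c * d          ≈⟨ p ⟩
      a * (b * b′)   ≈⟨ solve 3 (λ a b b′ → a :* (b :* b′) := a :* b′ :* b) ≈-refl a b b′ ⟩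
      a * b′ * b     ∎))
    with e′ , e≈ ← cancel′ e (λ i≢j → let a , d , σd , p = regular i≢j in a , d , σd , *-cancelʳ b≉0 (begin
      e * d * b      ≈⟨ solve 3 (λ e d b → e :* d :* b := e :* b :* d) ≈-refl e d b ⟩
      e * b * d      ≈⟨ *-congʳ c≈ ⟨
      c * d          ≈⟨ p ⟩
      a * (b * b′)   ≈⟨ solve 3 (λ a b b′ → a :* (b :* b′) := a :* b′ :* b) ≈-refl a b b′ ⟩
      a * b′ * b     ∎)) = e′ , (begin
      c              ≈⟨ c≈ ⟩
      e * b          ≈⟨ *-congʳ e≈ ⟩
      e′ * b′ * b    ≈⟨ solve 3 (λ e b b′ → e :* b′ :* b := e :* (b :* b′)) ≈-refl e′ b b′ ⟩
      e′ * (b * b′)  ∎)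

  module _ {i j : Fin n} (i≢j : i ≢ j) where
    open Merge i j
    open Regularity ℚ[x n ] σ-isRingHom hiding (Regular)
    private module σ = RingMorphisms.IsRingHomomorphism σ-isRingHom

    merge-j : merge j ≡ j
    merge-j = merge-other (i≢j ∘ ≡.sym)

    σ-difference : ∀ a b → σ (difference a b) ≈ difference (merge a) (merge b)
    σ-difference a b = ≈-trans (σ.+-homo (x a) (- x b))
      (+-cong (σ-x a) (≈-trans (σ.-‿homo (x b)) (-‿cong (σ-x b))))

    σ-difference-ij : σ (difference i j) ≈ 0#
    σ-difference-ij = ≈-trans (σ-difference i j)
      (≈-trans (reflexive (cong₂ difference merge-i merge-j)) (-‿inverseʳ (x j)))

    σ-*-zero : ∀ {p} q → σ p ≈ 0# → σ (p * q) ≈ 0#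
    σ-*-zero q σp≈0 = ≈-trans (σ.*-homo _ q) (≈-trans (*-congʳ σp≈0) (zeroˡ _))

    -- Regularity along x_i = x_j alone suffices: σ kills the product of c with a denominator that
    -- it does not kill, hence kills c.
    cancellable-difference : Cancellable (difference i j)
    cancellable-difference c regular with a , b , σb≉0 , cb≈ad ← regular i≢j =
      σ-kernel c ([ (λ e → e) , (λ e → contradiction e σb≉0) ]′ (domain (σ c) (σ b) (begin
        σ c * σ b                    ≈⟨ σ.*-homo c b ⟨
        σ (c * b)                    ≈⟨ σ.⟦⟧-cong (≈-trans cb≈ad (*-comm a _)) ⟩
        σ (difference i j * a)       ≈⟨ σ-*-zero a σ-difference-ij ⟩
        0#                           ∎)))

    -- This identifies the walks from i to j and from j to i through the same vertices, whence the
    -- opposite residues.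
    σ-walk-cong : ∀ {a a′ z z′} w → merge a ≡ merge a′ → merge z ≡ merge z′ →
      σ (walk a w z) ≈ σ (walk a′ w z′)
    σ-walk-cong {a} {a′} {z} {z′} [] ea ez = ≈-trans (σ-difference a z)
      (≈-trans (reflexive (cong₂ difference ea ez)) (≈-sym (σ-difference a′ z′)))
    σ-walk-cong {a} {a′} {z} {z′} (b ∷ w) ea ez = ≈-trans (σ.*-homo _ _)
      (≈-trans (*-cong (σ-walk-cong {a} {a′} {b} {b} [] ea refl) (σ-walk-cong w refl ez))
        (≈-sym (σ.*-homo _ _)))

    -- After merging, the walk leaves j and returns to it through distinct other vertices. The
    -- intermediate vertex c is essential: the direct step from i to j is killed.
    σ-walk≉0 : ∀ {a z c w} → merge a ≡ j → merge z ≡ j → All (i ≢_) (c ∷ w) → All (j ≢_) (c ∷ w) →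
      Unique (c ∷ w) → ¬ (σ (walk a (c ∷ w) z) ≈ 0#)
    σ-walk≉0 {a} {z} {c} {w} ea ez i≢ j≢ w! = walk-closed {R = λ a b → merge a ≢ merge b}
      {P = λ p → ¬ (σ p ≈ 0#)} σ-*-≉0
      (λ {a} {b} ≢ e → ≢ (x-injective (x∙y⁻¹≈ε⇒x≈y _ _ (≈-trans (≈-sym (σ-difference a b)) e))))
      {a} {c ∷ w} {z}
      ((λ e → All.head j≢ (≡.trans (≡.sym ea) (≡.trans e (fixed (All.head i≢)))))
        ∷ AllPairs⇒Linked (AllPairs-∷ʳ
          (AllPairs-map-All
            (λ i≢a i≢b a≢b e → a≢b (≡.trans (≡.sym (fixed i≢a)) (≡.trans e (fixed i≢b)))) i≢ w!)
          (All.zipWith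
            (λ (i≢a , j≢a) e → j≢a (≡.sym (≡.trans (≡.sym (fixed i≢a)) (≡.trans e ez)))) (i≢ , j≢))))
      where
      fixed : ∀ {k} → i ≢ k → merge k ≡ k
      fixed i≢k = merge-other (i≢k ∘ ≡.sym)

  total⇒3≤length : 3 ≤ n → ∀ {w : List (Fin n)} → IsTotalOrder w → 3 ≤ length w
  total⇒3≤length 3≤n w↭ =
    subst (3 ≤_) (≡.sym (≡.trans (↭-length w↭) (List.length-tabulate (λ i → i)))) 3≤n

  Admissible : Polynomial n → Set
  Admissible b = ¬ (b ≈ 0#) × Cancellable b

  cyclicProduct-admissible : 3 ≤ n → ∀ {w} → IsTotalOrder w → Admissible (cyclicProduct w)
  cyclicProduct-admissible 3≤n {w} w↭ with w | total⇒3≤length 3≤n w↭ | total⇒unique w↭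
  ... | _ ∷ []    | s≤s () | _
  ... | a ∷ c ∷ u | _      | a≢ ∷ u! =
    (λ e → proj₁ admissible (≈-trans (≈-sym (∏-zipWith≈walk a (c ∷ u) a)) e)) ,
    cancellable-resp-≈ (≈-sym (∏-zipWith≈walk a (c ∷ u) a)) (proj₂ admissible)
    where
    admissible : Admissible (walk a (c ∷ u) a)
    admissible = walk-closed {R = _≢_} {P = Admissible}
      (λ (p≉0 , p) (q≉0 , q) → *-≉0 p≉0 q≉0 , cancellable-* p≉0 p q)
      (λ i≢j → difference≉0 i≢j , cancellable-difference i≢j)
      {a} {c ∷ u} {a}
      (All.head a≢ ∷ AllPairs⇒Linked (AllPairs-∷ʳ u! (All.map (_∘ ≡.sym) a≢)))

  denominator-Ψ-cancellable : 3 ≤ n → ∀ {ws} → All IsTotalOrder ws → Cancellable (denominator (Ψ ws))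
  denominator-Ψ-cancellable 3≤n []               = cancellable-1
  denominator-Ψ-cancellable 3≤n (w↭ ∷ ws↭)
    with ≉0 , cancellable ← cyclicProduct-admissible 3≤n w↭ =
    cancellable-* (λ e → ≉0 (≈-trans (≈-sym (/-denominator {1#} ≉0)) e))
      (cancellable-resp-≈ (≈-sym (/-denominator {1#} ≉0)) cancellable)
      (denominator-Ψ-cancellable 3≤n ws↭)

  Ψ-order-≈ᵗ : ∀ {u v} → u ≈ᵗ v → Ψ-order u ≃ Ψ-order v
  Ψ-order-≈ᵗ s = /-congˡ (cyclicProduct-≈ᵗ s)

  Ψ-↭ : ∀ {us vs} → us ↭ᵗ vs → Ψ us ≃ Ψ vs
  Ψ-↭ us↭vs = SetoidPermutationₚ.foldr-commMonoid +ᶠ.setoid +ᶠ.isCommutativeMonoid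
    (SetoidPermutationₚ.map⁺ ≈ᵗ-setoid +ᶠ.setoid Ψ-order-≈ᵗ us↭vs)

  -- The poles along one hyperplane x_i = x_j

  module _ {i j : Fin n} (i≢j : i ≢ j) (3≤n : 3 ≤ n) where
    open Merge i j
    open Regularity ℚ[x n ] σ-isRingHom hiding (Regular)
    private module σ = RingMorphisms.IsRingHomomorphism σ-isRingHom

    -- The third vertex separates the two neighbours on their other side, so the pole is simple.
    uncons-rest : ∀ {a b : Fin n} {u} → IsTotalOrder (a ∷ b ∷ u) → ∃[ c ] ∃[ v ] u ≡ c ∷ v
    uncons-rest {u = u} w↭ with u | total⇒3≤length 3≤n w↭
    ... | []    | s≤s (s≤s ())
    ... | c ∷ v | _ = c , v , refl

    cyclicProduct-before : ∀ u → cyclicProduct (i ∷ j ∷ u) ≈ difference i j * walk j u i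
    cyclicProduct-before u = ∏-zipWith≈walk i (j ∷ u) i

    -- The sign of x_j - x_i moves into the cofactor, so that both neighbouring positions share the
    -- factor x_i - x_j.
    cyclicProduct-after : ∀ u → cyclicProduct (j ∷ i ∷ u) ≈ difference i j * (- walk i u j)
    cyclicProduct-after u = begin
      cyclicProduct (j ∷ i ∷ u)              ≈⟨ ∏-zipWith≈walk j (i ∷ u) j ⟩
      difference j i * walk i u j            ≈⟨ *-congʳ (-difference i j) ⟨
      - difference i j * walk i u j          ≈⟨ -‿distribˡ-* _ _ ⟨
      - (difference i j * walk i u j)        ≈⟨ -‿cong (*-comm _ _) ⟩
      - (walk i u j * difference i j)        ≈⟨ -‿distribˡ-* _ _ ⟩
      - walk i u j * difference i j          ≈⟨ *-comm _ _ ⟩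
      difference i j * (- walk i u j)        ∎

    σ-walk-before≉0 : ∀ {u} → IsTotalOrder (i ∷ j ∷ u) → ¬ (σ (walk j u i) ≈ 0#)
    σ-walk-before≉0 w↭ with uncons-rest w↭ | total⇒unique w↭
    ... | c , v , refl | (_ ∷ i≢) ∷ j≢ ∷ u! = σ-walk≉0 i≢j (merge-j i≢j) merge-i i≢ j≢ u!

    σ-walk-after≉0 : ∀ {u} → IsTotalOrder (j ∷ i ∷ u) → ¬ (σ (- walk i u j) ≈ 0#)
    σ-walk-after≉0 {u} w↭ e with uncons-rest w↭ | total⇒unique w↭
    ... | c , v , refl | (_ ∷ j≢) ∷ i≢ ∷ u! =
      σ-walk≉0 i≢j merge-i (merge-j i≢j) i≢ j≢ u! (begin
        σ (walk i u j)         ≈⟨ ⁻¹-involutive _ ⟨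
        - (- σ (walk i u j))   ≈⟨ -‿cong (≈-trans (≈-sym (σ.-‿homo _)) e) ⟩
        - 0#                   ≈⟨ ε⁻¹≈ε ⟩
        0#                     ∎)

    σ-cyclicProduct-apart≉0 : ∀ {a u b v} → IsTotalOrder (i ∷ (a ∷ u) ++ j ∷ (b ∷ v)) →
      ¬ (σ (cyclicProduct (i ∷ (a ∷ u) ++ j ∷ (b ∷ v))) ≈ 0#)
    σ-cyclicProduct-apart≉0 {a} {u} {b} {v} w↭ e with total⇒unique w↭
    ... | i≢ ∷ rest! with AllPairs-++⁻ (a ∷ u) rest!
          -- Moving j to the front shows at once that it differs from the vertices on both sides.
          | AllPairs.head (Unique-resp-↭ (++-comm (a ∷ u) (j ∷ b ∷ v)) rest!)
    ...   | au! , (_ ∷ bv!) | j≢ =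
      σ-*-≉0
        (σ-walk≉0 i≢j {i} {j} merge-i (merge-j i≢j) (All.++⁻ˡ (a ∷ u) i≢) (All.++⁻ʳ (b ∷ v) j≢) au!)
        (σ-walk≉0 i≢j {j} {i} (merge-j i≢j) merge-i
          (All.tail (All.++⁻ʳ (a ∷ u) i≢)) (All.++⁻ˡ (b ∷ v) j≢) bv!)
        (≈-trans (≈-sym (σ.⟦⟧-cong (≈-trans (∏-zipWith≈walk i (a ∷ u ++ j ∷ b ∷ v) i)
          (walk-++ i (a ∷ u) j (b ∷ v) i)))) e)

    regularMultiple-Ψ-order : ∀ e {w} → IsTotalOrder w → ¬ (σ (cyclicProduct w) ≈ 0#) →
      RegularMultiple e (Ψ-order w)
    regularMultiple-Ψ-order e {w} w↭ σ≉0 = regular-unit λ e′ → σ≉0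
      (≈-trans (≈-sym (σ.⟦⟧-cong (/-denominator {1#} (proj₁ (cyclicProduct-admissible 3≤n w↭))))) e′)

    regularMultiple-simplePole : ∀ e q {w} → IsTotalOrder w → ¬ (σ q ≈ 0#) →
      cyclicProduct w ≈ difference i j * q → RegularMultiple (difference i j * e) (Ψ-order w)
    regularMultiple-simplePole e q {w} w↭ σq≉0 cyc≈ = e , q , σq≉0 , (begin
      difference i j * e * numerator (Ψ-order w) * q  ≈⟨ *-congʳ (*-congˡ (/-numerator w≉0)) ⟩
      difference i j * e * 1# * q
        ≈⟨ solve 3 (λ d e q → d :* e :* con 1 :* q := e :* (d :* q)) ≈-refl (difference i j) e q ⟩
      e * (difference i j * q)                        ≈⟨ *-congˡ cyc≈ ⟨
      e * cyclicProduct w                             ≈⟨ *-congˡ (/-denominator {1#} w≉0) ⟨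
      e * denominator (Ψ-order w)                     ∎)
      where w≉0 = proj₁ (cyclicProduct-admissible 3≤n w↭)

    regularMultiple-Ψ-order-edge : ∀ e {w} → IsTotalOrder w →
      RegularMultiple (difference i j * e) (Ψ-order w)
    regularMultiple-Ψ-order-edge e {w} w↭
      with cyclicPosition i≢j (total⇒∈ w↭ i) (total⇒∈ w↭ j)
    ... | before u s = regularMultiple-simplePole e _ w↭
          (σ-walk-before≉0 {u} (total-resp-≈ᵗ s w↭))
          (≈-trans (cyclicProduct-≈ᵗ s) (cyclicProduct-before u))
    ... | after u s = regularMultiple-simplePole e _ w↭
          (σ-walk-after≉0 {u} (total-resp-≈ᵗ s w↭))
          (≈-trans (cyclicProduct-≈ᵗ s) (cyclicProduct-after u))
    ... | apart a u b v s = regularMultiple-Ψ-order _ w↭ λ e →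
          σ-cyclicProduct-apart≉0 {a} {u} {b} {v} (total-resp-≈ᵗ s w↭)
            (≈-trans (≈-sym (σ.⟦⟧-cong (cyclicProduct-≈ᵗ s))) e)

    -- The residues of the two terms along x_i = x_j are opposite.
    regularMultiple-pair : ∀ e {w w′ u} → IsTotalOrder w → IsTotalOrder w′ →
      w ≈ᵗ i ∷ j ∷ u → w′ ≈ᵗ j ∷ i ∷ u → RegularMultiple e (Ψ-order w +ᶠ Ψ-order w′)
    regularMultiple-pair e {w} {w′} {u} w↭ w′↭ s s′ with σ-kernel (p + q) σ[p+q]≈0
      where
      p = walk j u i
      q = - walk i u j
      ji≡ : merge j ≡ merge i
      ji≡ = ≡.trans (merge-j i≢j) (≡.sym merge-i)
      σ[p+q]≈0 : σ (p + q) ≈ 0#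
      σ[p+q]≈0 = begin
        σ (p + q)                            ≈⟨ σ.+-homo p q ⟩
        σ p + σ q                            ≈⟨ +-cong (σ-walk-cong i≢j {j} {i} {i} {j} u ji≡ (≡.sym ji≡)) (σ.-‿homo _) ⟩
        σ (walk i u j) - σ (walk i u j)      ≈⟨ -‿inverseʳ _ ⟩
        0#                                   ∎
    -- 1/(d p) + 1/(d q) = (p + q)/(d p q), and p + q = f d removes the pole.
    ... | f , p+q≈ = e * f , p * q ,
      σ-*-≉0 (σ-walk-before≉0 {u} (total-resp-≈ᵗ s w↭)) (σ-walk-after≉0 {u} (total-resp-≈ᵗ s′ w′↭)) ,
      (begin
        e * (n₁ * d₂ + n₂ * d₁) * (p * q)
          ≈⟨ *-congʳ (*-congˡ (+-cong (*-cong (/-numerator w≉0) d₂≈) (*-cong (/-numerator w′≉0) d₁≈))) ⟩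
        e * (1# * (d * q) + 1# * (d * p)) * (p * q)
          ≈⟨ solve 4 (λ e d p q → e :* (con 1 :* (d :* q) :+ con 1 :* (d :* p)) :* (p :* q) :=
               e :* (d :* (p :+ q)) :* (p :* q)) ≈-refl e d p q ⟩
        e * (d * (p + q)) * (p * q)
          ≈⟨ *-congʳ (*-congˡ (*-congˡ p+q≈)) ⟩
        e * (d * (f * d)) * (p * q)
          ≈⟨ solve 5 (λ e d f p q → e :* (d :* (f :* d)) :* (p :* q) :=
               e :* f :* ((d :* p) :* (d :* q))) ≈-refl e d f p q ⟩
        e * f * ((d * p) * (d * q))
          ≈⟨ *-congˡ (*-cong d₁≈ d₂≈) ⟨
        e * f * (d₁ * d₂) ∎)
      where
      p = walk j u i
      q = - walk i u j
      d = difference i j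
      n₁ = numerator (Ψ-order w)
      n₂ = numerator (Ψ-order w′)
      d₁ = denominator (Ψ-order w)
      d₂ = denominator (Ψ-order w′)
      w≉0 = proj₁ (cyclicProduct-admissible 3≤n w↭)
      w′≉0 = proj₁ (cyclicProduct-admissible 3≤n w′↭)
      d₁≈ : d₁ ≈ d * p
      d₁≈ = ≈-trans (/-denominator {1#} w≉0) (≈-trans (cyclicProduct-≈ᵗ s) (cyclicProduct-before u))
      d₂≈ : d₂ ≈ d * q
      d₂≈ = ≈-trans (/-denominator {1#} w′≉0) (≈-trans (cyclicProduct-≈ᵗ s′) (cyclicProduct-after u))

    regularMultiple-∑ : ∀ e {fs} → All (RegularMultiple e) fs → RegularMultiple e (∑ fs)
    regularMultiple-∑ e []       = regularMultiple-0 e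
    regularMultiple-∑ e {f ∷ fs} (r ∷ rs) = regularMultiple-+ e {f} {∑ fs} r (regularMultiple-∑ e rs)

    regularMultiple-Ψ-edge : ∀ e {ws} → All IsTotalOrder ws →
      RegularMultiple (difference i j * e) (Ψ ws)
    regularMultiple-Ψ-edge e ws↭ =
      regularMultiple-∑ _ (All.map⁺ (All.map (λ {w} → regularMultiple-Ψ-order-edge e {w}) ws↭))

    -- Defined by the presence of a pole, which is decidable and invariant under rotation;
    -- `adjacent⇒` recovers the positions.
    Adjacent : List (Fin n) → Set
    Adjacent w = σ (cyclicProduct w) ≈ 0#

    adjacent? : ∀ w → Dec (Adjacent w)
    adjacent? w = σ (cyclicProduct w) ≟0

    regularMultiple-Ψ-nonadjacent : ∀ e {ws} → All IsTotalOrder ws → All (¬_ ∘ Adjacent) ws →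
      RegularMultiple e (Ψ ws)
    regularMultiple-Ψ-nonadjacent e ws↭ ws∤ = regularMultiple-∑ e (All.map⁺
      (All.zipWith (λ {w} (w↭ , w∤) → regularMultiple-Ψ-order e {w} w↭ w∤) (ws↭ , ws∤)))

    adjacent-resp-≈ᵗ : ∀ {u v} → u ≈ᵗ v → Adjacent u → Adjacent v
    adjacent-resp-≈ᵗ s = ≈-trans (≈-sym (σ.⟦⟧-cong (cyclicProduct-≈ᵗ s)))

    adjacent-before : ∀ u → Adjacent (i ∷ j ∷ u)
    adjacent-before u = ≈-trans (σ.⟦⟧-cong (cyclicProduct-before u))
      (σ-*-zero i≢j _ (σ-difference-ij i≢j))

    adjacent-after : ∀ u → Adjacent (j ∷ i ∷ u)
    adjacent-after u = ≈-trans (σ.⟦⟧-cong (cyclicProduct-after u))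
      (σ-*-zero i≢j _ (σ-difference-ij i≢j))

    adjacent⇒ : ∀ {w} → IsTotalOrder w → Adjacent w → ∃[ u ] (w ≈ᵗ i ∷ j ∷ u ⊎ w ≈ᵗ j ∷ i ∷ u)
    adjacent⇒ w↭ w∣ with cyclicPosition i≢j (total⇒∈ w↭ i) (total⇒∈ w↭ j)
    ... | before u s      = u , inj₁ s
    ... | after u s       = u , inj₂ s
    ... | apart a u b v s = contradiction (adjacent-resp-≈ᵗ s w∣)
          (σ-cyclicProduct-apart≉0 {a} {u} {b} {v} (total-resp-≈ᵗ s w↭))

    -- When i and j are neighbours, relabelling amounts to exchanging their places; it is an
    -- involution on all lists and commutes with rotation.
    swapLabels : List (Fin n) → List (Fin n)
    swapLabels = map (transpose i j)

    swapLabels-involutive : ∀ w → swapLabels (swapLabels w) ≡ w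
    swapLabels-involutive w = ≡.trans (≡.sym (List.map-∘ w))
      (≡.trans (List.map-cong (transpose-involutive i j) w) (List.map-id w))

    swapLabels-fixed : ∀ {u} → All (i ≢_) u → All (j ≢_) u → swapLabels u ≡ u
    swapLabels-fixed i≢ j≢ = List.map-id-local
      (All.zipWith (λ (i≢k , j≢k) → transpose-other i j (i≢k ∘ ≡.sym) (j≢k ∘ ≡.sym)) (i≢ , j≢))

    swapLabels-before : ∀ {u w} → IsTotalOrder w → w ≈ᵗ i ∷ j ∷ u → swapLabels w ≈ᵗ j ∷ i ∷ u
    swapLabels-before {u} {w} w↭ s with total⇒unique (total-resp-≈ᵗ s w↭)
    ... | (_ ∷ i≢) ∷ j≢ ∷ _ = subst (swapLabels w ≈ᵗ_)
      (cong₂ _∷_ (transpose-fst i j) (cong₂ _∷_ (transpose-snd i j) (swapLabels-fixed i≢ j≢)))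
      (map-≈ᵗ (transpose i j) s)

    swapLabels-after : ∀ {u w} → IsTotalOrder w → w ≈ᵗ j ∷ i ∷ u → swapLabels w ≈ᵗ i ∷ j ∷ u
    swapLabels-after {u} {w} w↭ s with total⇒unique (total-resp-≈ᵗ s w↭)
    ... | (_ ∷ j≢) ∷ i≢ ∷ _ = subst (swapLabels w ≈ᵗ_)
      (cong₂ _∷_ (transpose-snd i j) (cong₂ _∷_ (transpose-fst i j) (swapLabels-fixed i≢ j≢)))
      (map-≈ᵗ (transpose i j) s)

    -- Pairs without an arc: residues cancel in pairs

    module _ {Q : Quiver n} (¬i⟶j : ¬ Quiver._⟶_ Q i j) (¬j⟶i : ¬ Quiver._⟶_ Q j i)
      {ws : List (List (Fin n))} (enumerates : Enumerates _≈ᵗ_ (IsToricTotalExtension Q) ws) where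

      open Enumerates enumerates
      open SetoidMembership (≈ᵗ-setoid {n}) using () renaming (_∈_ to _∈ᵗ_)

      adjacents : List (List (Fin n))
      adjacents = filter adjacent? ws

      adjacents-extensions : All (λ w → TotalExtension Q w × Adjacent w) adjacents
      adjacents-extensions = All.zip
        ( All.filter⁺ adjacent? (All.map toricTotalExtension⇒ sound)
        , All.all-filter adjacent? ws )

      swapLabels-extension : ∀ {w} → TotalExtension Q w → Adjacent w →
        TotalExtension Q (swapLabels w) × Adjacent (swapLabels w)
      swapLabels-extension {w} ext w∣ with adjacent⇒ (proj₁ ext) w∣
      ... | u , inj₁ s = let s′ = swapLabels-before (proj₁ ext) s in
        totalExtension-resp-≈ᵗ (≈ᵗ-sym s′)
          (totalExtension-swap ¬i⟶j ¬j⟶i (totalExtension-resp-≈ᵗ s ext)) ,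
        adjacent-resp-≈ᵗ (≈ᵗ-sym s′) (adjacent-after u)
      ... | u , inj₂ s = let s′ = swapLabels-after (proj₁ ext) s in
        totalExtension-resp-≈ᵗ (≈ᵗ-sym s′)
          (totalExtension-swap ¬j⟶i ¬i⟶j (totalExtension-resp-≈ᵗ s ext)) ,
        adjacent-resp-≈ᵗ (≈ᵗ-sym s′) (adjacent-before u)

      regularMultiple-swapLabels : ∀ e {w} → TotalExtension Q w → Adjacent w →
        RegularMultiple e (Ψ-order w +ᶠ Ψ-order (swapLabels w))
      regularMultiple-swapLabels e {w} ext w∣
        with proj₁ (proj₁ (swapLabels-extension ext w∣)) | adjacent⇒ (proj₁ ext) w∣
      ... | sw↭ | u , inj₁ s = regularMultiple-pair e {w} {swapLabels w} {u} (proj₁ ext) sw↭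
        s (swapLabels-before (proj₁ ext) s)
      ... | sw↭ | u , inj₂ s = regularMultiple-≃ e
        {Ψ-order (swapLabels w) +ᶠ Ψ-order w} {Ψ-order w +ᶠ Ψ-order (swapLabels w)}
        (+ᶠ-comm (Ψ-order (swapLabels w)) (Ψ-order w))
        (regularMultiple-pair e {swapLabels w} {w} {u} sw↭ (proj₁ ext)
          (swapLabels-after (proj₁ ext) s) s)

      swapLabels-∈ : ∀ {w} → TotalExtension Q w → Adjacent w → swapLabels w ∈ᵗ adjacents
      swapLabels-∈ ext w∣ =
        let sext , sw∣ = swapLabels-extension ext w∣
            w′ , w′∈ , s = find (complete (toricTotalExtension⇐ sext))
        in lose (∈-filter⁺ adjacent? w′∈ (adjacent-resp-≈ᵗ s sw∣)) s

      adjacents-↭ : adjacents ↭ᵗ map swapLabels adjacents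
      adjacents-↭ = unique∧involution⇒↭map ≈ᵗ-setoid (map-≈ᵗ (transpose i j))
        (λ w → subst (_≈ᵗ w) (≡.sym (swapLabels-involutive w)) ε)
        (AllPairs.filter⁺ adjacent? irredundant)
        (All.map (λ (ext , w∣) → swapLabels-∈ ext w∣) adjacents-extensions)

      regularMultiple-Ψ+swapped : ∀ e {vs} → All (λ w → TotalExtension Q w × Adjacent w) vs →
        RegularMultiple e (Ψ vs +ᶠ Ψ (map swapLabels vs))
      regularMultiple-Ψ+swapped e [] =
        regularMultiple-+ e {0ᶠ} {0ᶠ} (regularMultiple-0 e) (regularMultiple-0 e)
      regularMultiple-Ψ+swapped e {w ∷ vs} ((ext , w∣) ∷ exts) = regularMultiple-≃ e
        {(Ψ-order w +ᶠ Ψ-order (swapLabels w)) +ᶠ (Ψ vs +ᶠ Ψ (map swapLabels vs))}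
        {Ψ (w ∷ vs) +ᶠ Ψ (map swapLabels (w ∷ vs))}
        (+ᶠₚ.interchange (Ψ-order w) (Ψ-order (swapLabels w)) (Ψ vs) (Ψ (map swapLabels vs)))
        (regularMultiple-+ e {Ψ-order w +ᶠ Ψ-order (swapLabels w)} {Ψ vs +ᶠ Ψ (map swapLabels vs)}
          (regularMultiple-swapLabels e ext w∣) (regularMultiple-Ψ+swapped e exts))

      -- The sum over the partners is the same sum reindexed, so the paired sum is twice the wanted
      -- one.
      regularMultiple-Ψ-adjacents : ∀ e → RegularMultiple e (Ψ adjacents)
      regularMultiple-Ψ-adjacents e = regularMultiple-half (1+1≉0 n) e {Ψ adjacents}
        (regularMultiple-≃ e {Ψ adjacents +ᶠ Ψ (map swapLabels adjacents)} {Ψ adjacents +ᶠ Ψ adjacents}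
          (+ᶠ.∙-congˡ {Ψ adjacents} {Ψ (map swapLabels adjacents)} {Ψ adjacents}
            (≈-sym (Ψ-↭ adjacents-↭)))
          (regularMultiple-Ψ+swapped e adjacents-extensions))

      regularMultiple-Ψ-nonarc : ∀ e → RegularMultiple e (Ψ ws)
      regularMultiple-Ψ-nonarc e = go ws (All.map proj₁ sound) (regularMultiple-Ψ-adjacents e)
        where
        A B : List (List (Fin n)) → Fraction
        A vs = Ψ (filter adjacent? vs)
        B vs = Ψ (filter (¬? ∘ adjacent?) vs)

        split : ∀ vs → Ψ (filter adjacent? vs) +ᶠ Ψ (filter (¬? ∘ adjacent?) vs) ≃ Ψ vs
        split []       = +ᶠ-identityˡ 0ᶠ
        split (w ∷ vs) with adjacent? w
        ... | yes _ = ≃-trans {(Ψ-order w +ᶠ A vs) +ᶠ B vs} {Ψ-order w +ᶠ (A vs +ᶠ B vs)} {Ψ (w ∷ vs)}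
          (+ᶠ-assoc (Ψ-order w) (A vs) (B vs))
          (+ᶠ.∙-congˡ {Ψ-order w} {A vs +ᶠ B vs} {Ψ vs} (split vs))
        ... | no  _ = ≃-trans {A vs +ᶠ (Ψ-order w +ᶠ B vs)} {Ψ-order w +ᶠ (A vs +ᶠ B vs)} {Ψ (w ∷ vs)}
          (+ᶠₚ.x∙yz≈y∙xz (A vs) (Ψ-order w) (B vs))
          (+ᶠ.∙-congˡ {Ψ-order w} {A vs +ᶠ B vs} {Ψ vs} (split vs))
        go : ∀ vs → All IsTotalOrder vs → RegularMultiple e (Ψ (filter adjacent? vs)) →
          RegularMultiple e (Ψ vs)
        go vs vs↭ r = regularMultiple-≃ e
          {Ψ (filter adjacent? vs) +ᶠ Ψ (filter (¬? ∘ adjacent?) vs)} {Ψ vs} (split vs)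
          (regularMultiple-+ e {Ψ (filter adjacent? vs)} {Ψ (filter (¬? ∘ adjacent?) vs)} r
            (regularMultiple-Ψ-nonadjacent e (All.filter⁺ (¬? ∘ adjacent?) vs↭)
              (All.all-filter (¬? ∘ adjacent?) vs)))

  -- The edge product clears all poles

  module _ (3≤n : 3 ≤ n) {Q : Quiver n}
    {ws : List (List (Fin n))} (ws-enumerates : Enumerates _≈ᵗ_ (IsToricTotalExtension Q) ws)
    {es : List (Fin n × Fin n)} (es-enumerates : Enumerates _≡_ (IsHasseEdge Q) es) where

    open Quiver Q using (arc; _⟶_)
    private
      module ws = Enumerates ws-enumerates
      module es = Enumerates es-enumerates

      ws-total : All IsTotalOrder ws
      ws-total = All.map proj₁ ws.sound

    edgeProduct≉0 : ¬ (edgeProduct es ≈ 0#)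
    edgeProduct≉0 = ∏≉0 (All.map⁺ (All.map (λ (i<j , _) → difference≉0 (Fin.<⇒≢ i<j)) es.sound))

    nonedge⇒¬hasseArc : ∀ {i j} → i ≢ j → (i , j) ∉ es → (j , i) ∉ es → ¬ HasseArc Q i j
    nonedge⇒¬hasseArc {i} {j} i≢j ij∉ ji∉ h with Fin.<-cmp i j
    ... | tri< i<j _ _ = ij∉ (es.complete (i<j , inj₁ h))
    ... | tri≈ _ i≡j _ = i≢j i≡j
    ... | tri> _ _ j<i = ji∉ (es.complete (j<i , inj₂ h))

    longArc⇒nonadjacent : ∀ {i j} (i≢j : i ≢ j) → i ⟶ j ⊎ j ⟶ i →
      ¬ HasseArc Q i j → ¬ HasseArc Q j i → All (λ w → ¬ Adjacent i≢j 3≤n w) ws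
    longArc⇒nonadjacent {i} {j} i≢j arc ¬hij ¬hji =
      All.map (λ {w} → nonadjacent {w} ∘ toricTotalExtension⇒) ws.sound
      where
      excluded : ∀ u → ¬ TotalExtension Q (i ∷ j ∷ u) × ¬ TotalExtension Q (j ∷ i ∷ u)
      excluded u = [ (λ i⟶j → longArc-nonadjacent i⟶j ¬hij)
                   , (λ j⟶i → swap (longArc-nonadjacent j⟶i ¬hji)) ]′ arc
      nonadjacent : ∀ {w} → TotalExtension Q w → ¬ Adjacent i≢j 3≤n w
      nonadjacent ext w∣ = let u , position = adjacent⇒ i≢j 3≤n (proj₁ ext) w∣ in
        [ (λ s → proj₁ (excluded u) (totalExtension-resp-≈ᵗ s ext))
        , (λ s → proj₂ (excluded u) (totalExtension-resp-≈ᵗ s ext)) ]′ position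

    edgeProduct·Ψ-regular : ∀ {i j} → i ≢ j →
      Regular i j (edgeProduct es * numerator (Ψ ws)) (denominator (Ψ ws))
    edgeProduct·Ψ-regular {i} {j} i≢j =
      -- Membership in the finite list `es` decides what `HasseArc`, a negated existence, does not
      -- decide directly.
      byCases ((i , j) ∈? es) ((j , i) ∈? es) (T? (arc i j)) (T? (arc j i))
      where
      open DecMembership (Product.≡-dec _≟_ _≟_) using (_∈?_)
      open Regularity ℚ[x n ] (Merge.σ-isRingHom i j) using (RegularMultiple; regularMultiple-resp-≈)

      edge : ∀ e → edgeProduct es ≈ difference i j * e → RegularMultiple (edgeProduct es) (Ψ ws)
      edge e E≈ = regularMultiple-resp-≈ (Ψ ws) (≈-sym E≈) (regularMultiple-Ψ-edge i≢j 3≤n e ws-total)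

      long : (i , j) ∉ es → (j , i) ∉ es → i ⟶ j ⊎ j ⟶ i → RegularMultiple (edgeProduct es) (Ψ ws)
      long ij∉ ji∉ arc = regularMultiple-Ψ-nonadjacent i≢j 3≤n (edgeProduct es) ws-total
        (longArc⇒nonadjacent i≢j arc (nonedge⇒¬hasseArc i≢j ij∉ ji∉)
          (nonedge⇒¬hasseArc (i≢j ∘ ≡.sym) ji∉ ij∉))

      byCases : Dec ((i , j) ∈ es) → Dec ((j , i) ∈ es) → Dec (i ⟶ j) → Dec (j ⟶ i) →
        RegularMultiple (edgeProduct es) (Ψ ws)
      byCases (yes ij∈) _ _ _ = let e , E≈ = ∏-∈ (∈-map⁺ (uncurry difference) ij∈) in edge e E≈
      byCases (no _) (yes ji∈) _ _ =
       let e , E≈ = ∏-∈ (∈-map⁺ (uncurry difference) ji∈) in edge (- e) (begin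
        edgeProduct es              ≈⟨ E≈ ⟩
        difference j i * e          ≈⟨ *-congʳ (-difference i j) ⟨
        - difference i j * e        ≈⟨ -‿distribˡ-* _ _ ⟨
        - (difference i j * e)      ≈⟨ -‿distribʳ-* _ _ ⟩
        difference i j * - e        ∎)
      byCases (no _) (no _) (no ¬i⟶j) (no ¬j⟶i) =
        regularMultiple-Ψ-nonarc i≢j 3≤n ¬i⟶j ¬j⟶i ws-enumerates (edgeProduct es)
      byCases (no ij∉) (no ji∉) (yes i⟶j) _ = long ij∉ ji∉ (inj₁ i⟶j)
      byCases (no ij∉) (no ji∉) _ (yes j⟶i) = long ij∉ ji∉ (inj₂ j⟶i)

theorem1p6 : ∀ (n : ℕ) → 3 ≤ n → (Q : Quiver n) →
    ∀ (ws : List (List (Fin n))) → Enumerates _≈ᵗ_ (IsToricTotalExtension Q) ws →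
    ∀ (es : List (Fin n × Fin n)) → Enumerates _≡_ (IsHasseEdge Q) es →
    let open RationalFunctions n in
    Σ[ p ∈ Polynomial n ] Ψ ws ≃ p / edgeProduct es
theorem1p6 n 3≤n Q ws ws-enumerates es es-enumerates =
  let p , E·N≈p·D = denominator-Ψ-cancellable n 3≤n (All.map proj₁ (Enumerates.sound ws-enumerates))
        (edgeProduct es * numerator (Ψ ws)) (edgeProduct·Ψ-regular n 3≤n ws-enumerates es-enumerates)
  in p , (begin
    numerator (Ψ ws) * denominator (p / edgeProduct es)  ≈⟨ *-congˡ (/-denominator {p} E≉0) ⟩
    numerator (Ψ ws) * edgeProduct es                    ≈⟨ *-comm _ _ ⟩
    edgeProduct es * numerator (Ψ ws)                    ≈⟨ E·N≈p·D ⟩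
    p * denominator (Ψ ws)                               ≈⟨ *-congʳ (/-numerator E≉0) ⟨
    numerator (p / edgeProduct es) * denominator (Ψ ws)  ∎)
  where
  open IntegralDomain ℚ[x n ]
  open RationalFunctions n
  open Fractions ℚ[x n ]
  open SetoidReasoning setoid
  E≉0 = edgeProduct≉0 n 3≤n ws-enumerates es-enumerates
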